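{- Let $G$ be a host graph with edges ordered as $e_1,\dots,e_m$, and let $w=\max_{i\in[m]}|F_i|$ be its maximum frontier size with respect to this order. Given a multiset $s$ and a set $t$ of $c$-colored degrees, there is an algorithm to construct a $(c+1)$-DD $\mathbf{Z}^{c+1}(\mathcal{C}_s^t)$ over $E(G)$, that is, a $(c+1)$-DD representing the family $\mathcal{G}^c(\mathcal{C}_s^t)$ of all $c$-colored subgraphs of $G$ satisfying the constraint $\mathcal{C}_s^t$, with width at most $$2^{O(c\,w\log w)}\;\bigl|\mathcal{D}(s\cup t)\bigr|^{w}\;\prod_{\delta\in s}\bigl(s(\delta)+1\bigr),$$ where the product runs over the distinct elements $\delta$ of $s$ and $s(\delta)$ is the multiplicity of $\delta$ in $s$.
   Context: All graphs, sets and multisets are finite and graphs are simple; $[k]=\{1,\dots,k\}$; $\mathbb{N}$ is the set of non-negative integers; the number $c$ of colors is a positive integer; $O(\cdot)$ is the usual big-O notation. Colored graphs. A $c$-colored subset over a finite set $E$ is a $c$-tuple $(D_1,\dots,D_c)$ of pairwise disjoint subsets of $E$. A $c$-colored graph is a finite vertex set $U$ together with a $c$-colored subset $(D_1,\dots,D_c)$ over the set of unordered pairs of distinct elements of $U$; edges in $D_i$ have color $i$. A $c$-colored degree is a tuple in $\mathbb{N}^c$. The colored degree of a vertex $u$ is the $c$-tuple $(\delta_1,\dots,\delta_c)$ where $\delta_i$ is the number of color-$i$ edges incident to $u$. The colored degree multiset $\mathrm{DS}(F^c)$ of a $c$-colored graph $F^c$ is the multiset of colored degrees of all its vertices. The color-$i$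 subgraph of $F^c$ consists of the color-$i$ edges and their endpoints. Constraint $\mathcal{C}_s^t$. A $c$-colored graph $F^c$ satisfies $\mathcal{C}_s^t$ if and only if (a) $\mathrm{DS}(F^c)$ is obtained by adding to the multiset $s$ an arbitrary number (possibly zero) of elements of $t$, repetitions allowed, and (b) for each $i\in[c]$ the color-$i$ subgraph of $F^c$ is connected. Colored subgraphs of $G$. A $c$-colored subgraph of $G$ is identified with a $c$-colored subset $(D_1,\dots,D_c)$ over $E(G)$; it stands for the edge-induced $c$-colored graph whose vertices are the endpoints of edges in $D_1\cup\dots\cup D_c$. $\mathcal{G}^c(\mathcal{C})$ is the family of those satisfying $\mathcal{C}$. Frontier. The $i$-th frontier $F_i$ is the set of vertices of $G$ incident both to some edge in $\{e_1,\dots,e_{i-1}\}$ and to some edge in $\{e_i,\dots,e_m\}$. Decision diagrams. A $(c+1)$-DD over $E=\{e_1,\dots,e_m\}$ is a finite directed acyclic graph with a unique root node and two terminal nodes $\top,\bot$ (no outgoing arcs). Each non-terminal node $\alpha$ has a label $\ell(\alpha)\in[m]$ and exactly $c+1$ outgoing arcs, called its $0$-arc, $1$-arc, ..., $c$-arc; each arc from $\alpha$ points to a terminal node or to a non-terminal node with label $\ell(\alpha)+1$. A directed path from the root to $\top$ represents the $c$-colored subset $(B_1,\dots,B_c)$ with $B_j=\{e_{\ell(\beta)} : \text{the path uses the } j\text{ -arc of } \beta\}$. The DD represents the family of all $c$-colored subsets represented by its root-to-$\top$ paths. Its width is the maximum number of nodes with the same label. Domination. For tuples $\chi,\delta\in\mathbb{N}^c$,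 $\chi\le\delta$ means $\chi_i\le\delta_i$ for all $i$. For a set $M\subseteq\mathbb{N}^c$, $\mathcal{D}(M)=\{\chi\in\mathbb{N}^c : \exists\,\delta\in M,\ \chi\le\delta\}$. $s\cup t$ denotes the set of tuples appearing in $s$ or in $t$ (multiplicities ignored). -}

module Defs where

open import Data.Bool.Properties using (T-≡)
open import Data.Fin.Base using (Fin; suc; toℕ)
import Data.Fin.Base as Fin
import Data.Fin.Properties as Fin
open import Data.Fin.Subset using (Subset; _∩_; ∣_∣; Empty)
import Data.Fin.Subset as Subset
open import Data.Fin.Subset.Properties using (_∈?_)
open import Data.List.Base using (List; []; _∷_; _++_; map; filter; length; allFin; upTo; concatMap; cartesianProductWith; deduplicate; product; tabulate)
open import Data.List.Extrema.Nat using (max)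
open import Data.List.Membership.Propositional using (_∈_; find; lose)
open import Data.List.Membership.Propositional.Properties using (∈-deduplicate⁺; ∈-deduplicate⁻; ∈-concatMap⁺; ∈-concatMap⁻; ∈-cartesianProductWith⁺; ∈-cartesianProductWith⁻; ∈-upTo⁺; ∈-upTo⁻)
open import Data.List.Relation.Binary.Permutation.Propositional using (_↭_)
open import Data.List.Relation.Unary.All using (All)
open import Data.List.Relation.Unary.Any using (here; there)
open import Data.List.Relation.Unary.Unique.Propositional using (Unique)
open import Data.Nat.Base using (ℕ; suc; _≤_; s≤s; s≤s⁻¹)
import Data.Nat.Properties as ℕ
open import Data.Product.Base using (∃₂; ∃-syntax; _×_; _,_)
open import Data.Vec.Base using (Vec; []; _∷_)
import Data.Vec.Base as Vec
import Data.Vec.Properties as Vec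
open import Data.Vec.Relation.Binary.Pointwise.Inductive using (Pointwise; []; _∷_)
open import Function.Base using (_∘_)
open import Function.Bundles using (_⇔_; mk⇔; Equivalence)
open import Function.Definitions using (Injective)
open import Relation.Binary.Construct.Closure.ReflexiveTransitive using (Star)
open import Relation.Binary.Definitions using (DecidableEquality)
open import Relation.Binary.PropositionalEquality using (_≡_; _≢_; refl; sym; trans)
open import Relation.Nullary.Decidable using (⌊_⌋; toWitness; fromWitness; _×-dec_)
open import Relation.Unary using (Pred; Decidable)
open import Level using (0ℓ)

comprehension : ∀ {n} {P : Pred (Fin n) 0ℓ} → Decidable P → Subset n
comprehension P? = Vec.tabulate (⌊_⌋ ∘ P?)

∈-comprehension : ∀ {n} {P : Pred (Fin n) 0ℓ} (P? : Decidable P) {x : Fin n} →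
                  x Subset.∈ comprehension P? ⇔ P x
∈-comprehension P? {x} = mk⇔
  (λ x∈ → toWitness {a? = P? x} (Equivalence.from T-≡
            (trans (sym (Vec.lookup∘tabulate (⌊_⌋ ∘ P?) x)) (Vec.[]=⇒lookup x∈))))
  (λ Px → Vec.lookup⇒[]= x _
            (trans (Vec.lookup∘tabulate (⌊_⌋ ∘ P?) x)
                   (Equivalence.to T-≡ (fromWitness {a? = P? x} Px))))

------------------------------------------------------------------------
-- Graphs with ordered edges

-- An edge is a two-element set of vertices; `edge` lists E(G) in the chosen
-- order, without repetition.  Edges are indexed from 0.
record Graph : Set where
  field
    n m            : ℕ
    edge           : Fin m → Subset n
    edge-size      : ∀ e → ∣ edge e ∣ ≡ 2
    edge-injective : Injective _≡_ _≡_ edge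

module _ (G : Graph) where
  open Graph G

  InFrontier : Fin m → Fin n → Set
  InFrontier i v = (∃[ e ] (e Fin.< i × v Subset.∈ edge e))
                 × (∃[ e ] (i Fin.≤ e × v Subset.∈ edge e))

  inFrontier? : ∀ i → Decidable (InFrontier i)
  inFrontier? i v = Fin.any? (λ e → (e Fin.<? i) ×-dec (v ∈? edge e))
              ×-dec Fin.any? (λ e → (i Fin.≤? e) ×-dec (v ∈? edge e))

  frontier : Fin m → Subset n
  frontier i = comprehension (inFrontier? i)

  -- Equal to 0 if there are no edges.
  maxFrontierSize : ℕ
  maxFrontierSize = max 0 (tabulate (λ i → ∣ frontier i ∣))

------------------------------------------------------------------------
-- Colored graphs

record ColoredSubset (c m : ℕ) : Set where
  field
    part     : Fin c → Subset m
    disjoint : ∀ i j → i ≢ j → Empty (part i ∩ part j)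

open ColoredSubset public

-- Any set of pairs may be colored when `host` is a complete graph; allowing
-- an arbitrary host lets a colored subgraph be colored over E(G) itself.
record ColoredGraph (c : ℕ) : Set where
  field
    host     : Graph
  open Graph host public
  field
    vertices : Subset n
    colors   : ColoredSubset c m
    closed   : ∀ {i e v} → e Subset.∈ part colors i → v Subset.∈ edge e →
               v Subset.∈ vertices

ColoredDegree : ℕ → Set
ColoredDegree c = Vec ℕ c

_≟ᵈ_ : ∀ {c} → DecidableEquality (ColoredDegree c)
_≟ᵈ_ = Vec.≡-dec ℕ._≟_

module _ {c : ℕ} (F : ColoredGraph c) where
  open ColoredGraph F

  incidentEdges : Fin n → Subset m
  incidentEdges u = comprehension (λ e → u ∈? edge e)

  coloredDegree : Fin n → ColoredDegree c
  coloredDegree u = Vec.tabulate (λ i → ∣ part colors i ∩ incidentEdges u ∣)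

  -- Multisets are lists up to _↭_.
  DS : List (ColoredDegree c)
  DS = map coloredDegree (filter (_∈? vertices) (allFin n))

  ColorVertex : Fin c → Fin n → Set
  ColorVertex i u = ∃[ e ] (e Subset.∈ part colors i × u Subset.∈ edge e)

  ColorAdjacent : Fin c → Fin n → Fin n → Set
  ColorAdjacent i u v =
    ∃[ e ] (e Subset.∈ part colors i × u ≢ v × u Subset.∈ edge e × v Subset.∈ edge e)

  -- The subgraph of an unused color has no vertices and counts as connected.
  ColorConnected : Fin c → Set
  ColorConnected i = ∀ u v → ColorVertex i u → ColorVertex i v →
                     Star (ColorAdjacent i) u v

  record Satisfies (s t : List (ColoredDegree c)) : Set where
    field
      degrees   : ∃[ r ] (All (_∈ t) r × DS ↭ s ++ r)
      connected : ∀ i → ColorConnected i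

module _ (G : Graph) {c : ℕ} where
  open Graph G

  Endpoint : ColoredSubset c m → Fin n → Set
  Endpoint D u = ∃₂ λ i e → e Subset.∈ part D i × u Subset.∈ edge e

  endpoint? : ∀ D → Decidable (Endpoint D)
  endpoint? D u = Fin.any? λ i → Fin.any? λ e → (e ∈? part D i) ×-dec (u ∈? edge e)

  edgeInduced : ColoredSubset c m → ColoredGraph c
  edgeInduced D = record
    { host     = G
    ; vertices = comprehension (endpoint? D)
    ; colors   = D
    ; closed   = λ e∈D v∈e →
        Equivalence.from (∈-comprehension (endpoint? D)) (_ , _ , e∈D , v∈e)
    }

  𝒢 : (ColoredGraph c → Set) → ColoredSubset c m → Set
  𝒢 C D = C (edgeInduced D)

------------------------------------------------------------------------
-- Decision diagrams

data Node (m : ℕ) (size : Fin m → ℕ) : Set where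
  ⊤-node ⊥-node : Node m size
  node          : (ℓ : Fin m) → Fin (size ℓ) → Node m size

-- A (c+1)-DD over an m-element edge set.  The non-terminal nodes with label ℓ
-- are `node ℓ a` for a : Fin (size ℓ).  Labels increase along arcs, so the
-- diagram is acyclic.  The root may be a terminal (e.g. for the empty family).
-- By `root-unique` every non-terminal is reachable from the root; a terminal
-- is always present, even if no arc points to it.
record DD (c m : ℕ) : Set where
  field
    size        : Fin m → ℕ
    root        : Node m size
    arc         : ∀ ℓ → Fin (size ℓ) → Fin (suc c) → Node m size
    arc-label   : ∀ {ℓ a j ℓ′ a′} → arc ℓ a j ≡ node ℓ′ a′ → toℕ ℓ′ ≡ suc (toℕ ℓ)
    root-unique : ∀ ℓ a → node ℓ a ≢ root →
                  ∃[ ℓ′ ] ∃[ a′ ] ∃[ j ] arc ℓ′ a′ j ≡ node ℓ a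

  width : ℕ
  width = max 0 (tabulate size)

  data PathToTop : Node m size → Set where
    done : PathToTop ⊤-node
    step : ∀ {ℓ a} (j : Fin (suc c)) → PathToTop (arc ℓ a j) → PathToTop (node ℓ a)

  -- UsesArc j e p : the path p uses the j-arc of a node labelled e.
  data UsesArc (j : Fin (suc c)) (e : Fin m) : ∀ {α} → PathToTop α → Set where
    here  : ∀ {a} {p : PathToTop (arc e a j)} → UsesArc j e (step j p)
    there : ∀ {ℓ a k} {p : PathToTop (arc ℓ a k)} →
            UsesArc j e p → UsesArc j e (step {ℓ} {a} k p)

  -- Colors are indexed from 0, so color j corresponds to the (suc j)-arcs.
  PathRepresents : PathToTop root → ColoredSubset c m → Set
  PathRepresents p B = ∀ j e → (e Subset.∈ part B j) ⇔ UsesArc (suc j) e p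

  Represents : (ColoredSubset c m → Set) → Set
  Represents 𝓕 = ∀ B → (∃[ p ] PathRepresents p B) ⇔ 𝓕 B

------------------------------------------------------------------------
-- Domination and multiplicities

_≼_ : ∀ {c} → ColoredDegree c → ColoredDegree c → Set
_≼_ = Pointwise _≤_

below : ∀ {c} → ColoredDegree c → List (ColoredDegree c)
below []      = [] ∷ []
below (d ∷ δ) = cartesianProductWith _∷_ (upTo (suc d)) (below δ)

-- 𝒟(M) as a list without repetitions; see ∈-𝒟 and 𝒟-unique.
𝒟 : ∀ {c} → List (ColoredDegree c) → List (ColoredDegree c)
𝒟 M = deduplicate _≟ᵈ_ (concatMap below M)

∈-below : ∀ {c} (δ : ColoredDegree c) {χ} → χ ∈ below δ ⇔ χ ≼ δ
∈-below δ = mk⇔ (to δ) from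
  where
  to : ∀ {c} (δ : ColoredDegree c) {χ} → χ ∈ below δ → χ ≼ δ
  to []      (here refl) = []
  to (d ∷ δ) χ∈
    with _ , _ , x∈ , χ′∈ , refl ← ∈-cartesianProductWith⁻ _∷_ (upTo (suc d)) (below δ) χ∈
    = s≤s⁻¹ (∈-upTo⁻ x∈) ∷ to δ χ′∈

  from : ∀ {c} {δ χ : ColoredDegree c} → χ ≼ δ → χ ∈ below δ
  from []          = here refl
  from (x≤d ∷ χ≼δ) = ∈-cartesianProductWith⁺ _∷_ (∈-upTo⁺ (s≤s x≤d)) (from χ≼δ)

∈-𝒟 : ∀ {c} (M : List (ColoredDegree c)) {χ} →
      χ ∈ 𝒟 M ⇔ (∃[ δ ] (δ ∈ M × χ ≼ δ))
∈-𝒟 M {χ} = mk⇔ to from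
  where
  to : χ ∈ 𝒟 M → ∃[ δ ] (δ ∈ M × χ ≼ δ)
  to χ∈
    with δ , δ∈M , χ∈δ ← find (∈-concatMap⁻ below {xs = M}
                                (∈-deduplicate⁻ _≟ᵈ_ (concatMap below M) χ∈))
    = δ , δ∈M , Equivalence.to (∈-below δ) χ∈δ

  from : ∃[ δ ] (δ ∈ M × χ ≼ δ) → χ ∈ 𝒟 M
  from (δ , δ∈M , χ≼δ) = ∈-deduplicate⁺ _≟ᵈ_
    (∈-concatMap⁺ below (lose δ∈M (Equivalence.from (∈-below δ) χ≼δ)))

module _ {c : ℕ} where
  open import Data.List.Relation.Unary.Unique.DecPropositional.Properties (_≟ᵈ_ {c}) using (deduplicate-!)

  𝒟-unique : (M : List (ColoredDegree c)) → Unique (𝒟 M)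
  𝒟-unique M = deduplicate-! (concatMap below M)

multiplicity : ∀ {c} → List (ColoredDegree c) → ColoredDegree c → ℕ
multiplicity s δ = length (filter (δ ≟ᵈ_) s)

∏[multiplicity+1] : ∀ {c} → List (ColoredDegree c) → ℕ
∏[multiplicity+1] s = product (map (λ δ → suc (multiplicity s δ)) (deduplicate _≟ᵈ_ s))

{-# OPTIONS --safe #-}
module Submission where

-- Call two colorings of the first edges equivalent if they have the same
-- accepted completions; the classes are the nodes of a decision diagram, as in
-- the Myhill–Nerode theorem.  All colorings without accepted completions are
-- equivalent.  The class of any other one is determined by
--   * the colored degree of every frontier vertex, which lies in 𝒟 (s ++ t);
--   * for every color, the partition of the frontier into components, and
--     whether some component avoids the frontier: if one does, then it is the
--     only one and the color is finished;
--   * for every δ in s, the number of vertices of degree δ that no remaining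
--     edge meets, capped at the multiplicity of δ in s.
-- Counting these data gives the bound.

open import Data.Bool.Base using (if_then_else_)
open import Data.Fin.Base as Fin using (Fin; zero; suc; toℕ; fromℕ<; combine; funToFin)
import Data.Fin.Properties as Fin
open import Data.Fin.Subset as Subset using (∣_∣; inside; outside; Subset)
open import Data.Fin.Subset.Properties using (_∈?_; x∈p∩q⁺; x∈p∩q⁻; p⊆q⇒∣p∣≤∣q∣)
open import Data.List.Base as List
  using (List; []; _∷_; length; lookup; deduplicate; allFin; cartesianProductWith; _++_;
         map; filter; cartesianProduct)
open import Data.List.Extrema.Nat using (xs≤max; f[argmax]≤v⁺)
open import Data.List.Membership.Propositional using (_∈_; lose; _∉_)
open import Data.List.Membership.Propositional.Properties
  using (∈-allFin; ∈-cartesianProductWith⁺; ∈-lookup; ∈-cartesianProduct⁺; ∈-filter⁺;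
         ∈-∃++; ∈-length; ∈-++⁺ˡ; ∈-++⁺ʳ; ∈-deduplicate⁺; ∈-map⁺)
import Data.List.Membership.Setoid.Properties as Setoidₘ
open import Data.List.Properties using (length-++; filter-++; filter-none)
open import Data.List.Relation.Binary.Permutation.Propositional
  using (_↭_; ↭-trans; ↭-refl; prep; ↭-reflexive)
open import Data.List.Relation.Binary.Permutation.Propositional.Properties
  using (filter-↭; ↭-length; shift; ↭-empty-inv)
open import Data.List.Relation.Unary.All as All using (All; []; _∷_)
open import Data.List.Relation.Unary.All.Properties as All using (all-filter; ¬Any⇒All¬)
open import Data.List.Relation.Unary.AllPairs using (AllPairs; []; _∷_)
open import Data.List.Relation.Unary.Any as Any using (Any; here; there)
open import Data.List.Relation.Unary.Any.Properties using (lookup-index)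
open import Data.List.Relation.Unary.Unique.DecSetoid.Properties using (deduplicate-!)
open import Data.Nat.Base
  using (ℕ; zero; suc; _+_; _≤_; _<_; z≤n; s≤s; s≤s⁻¹; _*_; _^_; _⊓_; _⊔_; NonZero;
         >-nonZero; >-nonZero⁻¹)
open import Data.Nat.ListAction using (product)
open import Data.Nat.Logarithm using (⌊log₂_⌋; ⌊log₂⌋-mono-≤; ⌊log₂[2^n]⌋≡n)
import Data.Nat.Properties as ℕ
open import Data.Product.Base using (∃; ∃-syntax; _×_; _,_; proj₁; proj₂; uncurry)
open import Data.Sum.Base as Sum using (_⊎_; inj₁; inj₂)
open import Data.Vec.Base as Vec using (Vec; []; _∷_; tabulate; _[_]≔_; zipWith)
import Data.Vec.Properties as Vec
open import Data.Vec.Relation.Binary.Pointwise.Inductive as Pointwise using (Pointwise; []; _∷_)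
open import Function.Base using (_∘_; id)
open import Function.Bundles using (_⇔_; mk⇔; Equivalence)
import Function.Properties.Equivalence as ⇔
open import Level using (0ℓ)
open import Relation.Binary.Bundles using (DecSetoid)
open import Relation.Binary.Construct.Closure.ReflexiveTransitive as Star
  using (Star; ε; _◅_; _◅◅_; reverse)
open import Relation.Binary.Core using (Rel)
open import Relation.Binary.Definitions as Binary using (Symmetric; Tri; tri<; tri≈; tri>)
open import Relation.Binary.PropositionalEquality
  using (_≡_; _≢_; refl; sym; trans; cong; subst; module ≡-Reasoning; cong₂; subst₂)
open import Relation.Nullary.Decidable
  using (Dec; yes; no; does; dec-true; dec-false; map′; _→-dec_; _×-dec_; ¬?; _⊎-dec_)
open import Relation.Nullary.Negation using (¬_; contradiction)
open import Relation.Unary using (Pred; Decidable)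

open import Defs

open Equivalence using (to; from)

-- Finite quotients

-- The recorded data need not fix the set of accepted completions on their own; liveness supplies
-- the rest. A count at the cap hides by how much it exceeds the multiplicity, and for a degree
-- outside `t` only an accepted completion rules out an excess. A closed component says nothing
-- about further components, and again only an accepted completion shows that there are none. Hence
-- a completion is carried over from one live prefix to another with the help of some completion
-- accepted after the second, and the dead prefixes are set apart at the cost of at most one extra
-- node per level.
--
-- Since nodes are defined by acceptance alone, the diagram is correct for every decidable set of
-- colorings. Frontiers enter only when the classes are counted.

AllPairs-lookup-injective : ∀ {A : Set} {R : Rel A 0ℓ} → Symmetric R →
  ∀ {xs} → AllPairs (λ x y → ¬ R x y) xs → ∀ i j → R (lookup xs i) (lookup xs j) → i ≡ j
AllPairs-lookup-injective sym-R (_ ∷ _)   zero    zero    _ = refl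
AllPairs-lookup-injective sym-R (x≉ ∷ _)  zero    (suc j) r =
  contradiction r (All.lookup x≉ (∈-lookup j))
AllPairs-lookup-injective sym-R (x≉ ∷ _)  (suc i) zero    r =
  contradiction (sym-R r) (All.lookup x≉ (∈-lookup i))
AllPairs-lookup-injective sym-R (_ ∷ pxs) (suc i) (suc j) r =
  cong suc (AllPairs-lookup-injective sym-R pxs i j r)

module Quotient (D : DecSetoid 0ℓ 0ℓ) (elements : List (DecSetoid.Carrier D))
                (complete : ∀ x → x ∈ elements) where
  open DecSetoid D using (Carrier; _≈_; _≟_; setoid)
    renaming (sym to ≈-sym; trans to ≈-trans; reflexive to ≈-reflexive)

  classes : List Carrier
  classes = deduplicate _≟_ elements

  representative : Fin (length classes) → Carrier
  representative = lookup classes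

  private
    ∈-classes : ∀ x → Any (x ≈_) classes
    ∈-classes x = Setoidₘ.∈-deduplicate⁺ setoid _≟_ (λ x≈y x≈z → ≈-trans x≈z (≈-sym x≈y))
                    (Any.map ≈-reflexive (complete x))

  class : Carrier → Fin (length classes)
  class x = Any.index (∈-classes x)

  ≈-representative : ∀ x → x ≈ representative (class x)
  ≈-representative x = lookup-index (∈-classes x)

  representative-injective : ∀ i j → representative i ≈ representative j → i ≡ j
  representative-injective = AllPairs-lookup-injective ≈-sym (deduplicate-! D elements)

  class-cong : ∀ {x y} → x ≈ y → class x ≡ class y
  class-cong {x} {y} x≈y = representative-injective _ _
    (≈-trans (≈-sym (≈-representative x)) (≈-trans x≈y (≈-representative y)))

  class-representative : ∀ i → class (representative i) ≡ i
  class-representative i = representative-injective _ _ (≈-sym (≈-representative (representative i)))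

  -- The codomain of `class` depends on the relation, that of `canonical` does not. This lets
  -- partitions of one set by two different relations be compared as functions.
  canonical : Carrier → Carrier
  canonical = representative ∘ class

  canonical-≡⇔ : ∀ {x y} → canonical x ≡ canonical y ⇔ x ≈ y
  canonical-≡⇔ {x} {y} = mk⇔
    (λ eq → ≈-trans (≈-representative x) (≈-trans (≈-reflexive eq) (≈-sym (≈-representative y))))
    (λ x≈y → cong representative (class-cong x≈y))

-- The decision diagram of a decidable set of colorings

vectors : ∀ k n → List (Vec (Fin k) n)
vectors k zero    = [] ∷ []
vectors k (suc n) = cartesianProductWith _∷_ (allFin k) (vectors k n)

∈-vectors : ∀ {k n} (v : Vec (Fin k) n) → v ∈ vectors k n
∈-vectors []      = here refl
∈-vectors (x ∷ v) = ∈-cartesianProductWith⁺ _∷_ (∈-allFin x) (∈-vectors v)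

lookup-ext : ∀ {A : Set} {n} {v w : Vec A n} → (∀ i → Vec.lookup v i ≡ Vec.lookup w i) → v ≡ w
lookup-ext {v = v} {w} eq =
  trans (sym (Vec.tabulate∘lookup v)) (trans (Vec.tabulate-cong eq) (Vec.tabulate∘lookup w))

-- Letter 0 leaves an edge uncolored and letter (suc i) gives it color i.
Coloring : ℕ → ℕ → Set
Coloring c m = Vec (Fin (suc c)) m

module _ {c m : ℕ} where

  opaque
    -- A prefix of length `k` is encoded as a full coloring whose letters from position `k` on are
    -- ignored. All levels thus share one type and one list of candidates.
    mix : ℕ → Coloring c m → Coloring c m → Coloring c m
    mix k f g = tabulate λ e → if does (toℕ e ℕ.<? k) then Vec.lookup f e else Vec.lookup g e

    lookup-mix-< : ∀ {k} f g {e} → toℕ e < k → Vec.lookup (mix k f g) e ≡ Vec.lookup f e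
    lookup-mix-< {k} f g {e} e<k = trans (Vec.lookup∘tabulate _ e)
      (cong (if_then Vec.lookup f e else Vec.lookup g e) (dec-true (toℕ e ℕ.<? k) e<k))

    lookup-mix-≥ : ∀ {k} f g {e} → k ≤ toℕ e → Vec.lookup (mix k f g) e ≡ Vec.lookup g e
    lookup-mix-≥ {k} f g {e} k≤e = trans (Vec.lookup∘tabulate _ e)
      (cong (if_then Vec.lookup f e else Vec.lookup g e) (dec-false (toℕ e ℕ.<? k) (ℕ.≤⇒≯ k≤e)))

  mix-all : ∀ {k} f g → m ≤ k → mix k f g ≡ f
  mix-all f g m≤k = lookup-ext λ e → lookup-mix-< f g (ℕ.<-≤-trans (Fin.toℕ<n e) m≤k)

  mix-none : ∀ f g → mix 0 f g ≡ g
  mix-none f g = lookup-ext λ e → lookup-mix-≥ f g z≤n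

  -- The letter at `ℓ` can be read as the last one of the longer prefix or as the first one of the
  -- completion. Every passage between consecutive levels rests on this.
  mix-update : ∀ ℓ j f g → mix (suc (toℕ ℓ)) (f [ ℓ ]≔ j) g ≡ mix (toℕ ℓ) f (g [ ℓ ]≔ j)
  mix-update ℓ j f g = lookup-ext λ e → at e (ℕ.<-cmp (toℕ e) (toℕ ℓ))
    where
    at : ∀ e → Tri (toℕ e < toℕ ℓ) (toℕ e ≡ toℕ ℓ) (toℕ ℓ < toℕ e) →
         Vec.lookup (mix (suc (toℕ ℓ)) (f [ ℓ ]≔ j) g) e ≡ Vec.lookup (mix (toℕ ℓ) f (g [ ℓ ]≔ j)) e
    at e (tri< e<ℓ e≢ℓ _) = trans (lookup-mix-< (f [ ℓ ]≔ j) g (ℕ.m<n⇒m<1+n e<ℓ))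
      (trans (Vec.lookup∘update′ (e≢ℓ ∘ cong toℕ) f j) (sym (lookup-mix-< f (g [ ℓ ]≔ j) e<ℓ)))
    at e (tri> _ e≢ℓ ℓ<e) = trans (lookup-mix-≥ (f [ ℓ ]≔ j) g ℓ<e)
      (sym (trans (lookup-mix-≥ f (g [ ℓ ]≔ j) (ℕ.<⇒≤ ℓ<e)) (Vec.lookup∘update′ (e≢ℓ ∘ cong toℕ) g j)))
    at e (tri≈ _ e≡ℓ _) with refl ← Fin.toℕ-injective e≡ℓ =
      trans (lookup-mix-< (f [ ℓ ]≔ j) g ℕ.≤-refl) (trans (Vec.lookup∘update ℓ f j)
        (sym (trans (lookup-mix-≥ f (g [ ℓ ]≔ j) ℕ.≤-refl) (Vec.lookup∘update ℓ g j))))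

  mix-step : ∀ ℓ f g → mix (suc (toℕ ℓ)) (f [ ℓ ]≔ Vec.lookup g ℓ) g ≡ mix (toℕ ℓ) f g
  mix-step ℓ f g = trans (mix-update ℓ (Vec.lookup g ℓ) f g) (cong (mix (toℕ ℓ) f) (Vec.[]≔-lookup g ℓ))

  -- A relation, because `represents` uses it both ways: a path to the top yields a coloring for a
  -- given `B`, and `B` yields one through `coloringOf`.
  Colors : Coloring c m → ColoredSubset c m → Set
  Colors h B = ∀ j e → e Subset.∈ part B j ⇔ Vec.lookup h e ≡ suc j

  colorOf : ColoredSubset c m → Fin m → Fin (suc c)
  colorOf B e with Fin.any? (λ j → e ∈? part B j)
  ... | yes (j , _) = suc j
  ... | no  _       = zero

  coloringOf : ColoredSubset c m → Coloring c m
  coloringOf B = tabulate (colorOf B)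

  colors-coloringOf : ∀ B → Colors (coloringOf B) B
  colors-coloringOf B j e rewrite Vec.lookup∘tabulate (colorOf B) e with Fin.any? (λ j → e ∈? part B j)
  ... | no ∄ = mk⇔ (λ e∈ → contradiction (j , e∈) ∄) (λ ())
  ... | yes (j′ , e∈′) = mk⇔ unique λ eq → subst (λ j → e Subset.∈ part B j) (Fin.suc-injective eq) e∈′
    where
    unique : e Subset.∈ part B j → suc j′ ≡ suc j
    unique e∈ with j′ Fin.≟ j
    ... | yes j′≡j = cong suc j′≡j
    ... | no  j′≢j = contradiction (e , x∈p∩q⁺ (e∈′ , e∈)) (disjoint B j′ j j′≢j)

module Diagram {c m : ℕ} (Accept : Pred (Coloring c m) 0ℓ) (accept? : Decidable Accept) where

  Residual≈ : ℕ → Rel (Coloring c m) 0ℓ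
  Residual≈ k f f′ = ∀ g → Accept (mix k f g) ⇔ Accept (mix k f′ g)

  residual≈? : ∀ k f f′ → Dec (Residual≈ k f f′)
  residual≈? k f f′ = map′ (λ all g → All.lookup all (∈-vectors g)) (λ ≈ → All.tabulate λ {g} _ → ≈ g)
    (All.all? (λ g → map′ (λ (p , q) → mk⇔ p q) (λ e → to e , from e)
        ((accept? (mix k f g) →-dec accept? (mix k f′ g)) ×-dec (accept? (mix k f′ g) →-dec accept? (mix k f g))))
      (vectors (suc c) m))

  residual : ℕ → DecSetoid 0ℓ 0ℓ
  residual k = record
    { _≈_ = Residual≈ k
    ; isDecEquivalence = record
      { isEquivalence = record
        { refl  = λ _ → ⇔.refl
        ; sym   = λ p g → ⇔.sym (p g)
        ; trans = λ p q g → ⇔.trans (p g) (q g)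
        }
      ; _≟_ = residual≈? k
      }
    }

  residual≈-step : ∀ ℓ j {f f′} → Residual≈ (toℕ ℓ) f f′ →
                   Residual≈ (suc (toℕ ℓ)) (f [ ℓ ]≔ j) (f′ [ ℓ ]≔ j)
  residual≈-step ℓ j {f} {f′} f≈f′ g
    rewrite mix-update ℓ j f g | mix-update ℓ j f′ g = f≈f′ (g [ ℓ ]≔ j)

  private
    module Q k = Quotient (residual k) (vectors (suc c) m) ∈-vectors

  size : Fin m → ℕ
  size ℓ = length (Q.classes (toℕ ℓ))

  target : ℕ → Coloring c m → Node m size
  target k f with k ℕ.<? m
  ... | yes k<m = node (fromℕ< k<m) (Q.class (toℕ (fromℕ< k<m)) f)
  ... | no  _ with accept? f
  ...   | yes _ = ⊤-node
  ...   | no  _ = ⊥-node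

  target-node : ∀ ℓ f → target (toℕ ℓ) f ≡ node ℓ (Q.class (toℕ ℓ) f)
  target-node ℓ f with toℕ ℓ ℕ.<? m
  ... | no  ℓ≮m = contradiction (Fin.toℕ<n ℓ) ℓ≮m
  ... | yes ℓ<m rewrite Fin.fromℕ<-toℕ ℓ ℓ<m = refl

  target-label : ∀ k f {ℓ a} → target k f ≡ node ℓ a → toℕ ℓ ≡ k
  target-label k f eq with k ℕ.<? m
  target-label k f refl | yes k<m = Fin.toℕ-fromℕ< k<m
  target-label k f eq   | no _ with accept? f
  target-label k f ()   | no _ | yes _
  target-label k f ()   | no _ | no _

  blank : Coloring c m
  blank = Vec.replicate m zero

  -- By `residual≈-step` another member of the class would lead to an equivalent coloring.
  arc : ∀ ℓ → Fin (size ℓ) → Fin (suc c) → Node m size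
  arc ℓ a j = target (suc (toℕ ℓ)) (Q.representative (toℕ ℓ) a [ ℓ ]≔ j)

  target-cong : ∀ {k} (ℓ : Fin m) {f f′} → toℕ ℓ ≡ k → Residual≈ k f f′ → target k f ≡ target k f′
  target-cong ℓ refl f≈f′ = trans (target-node ℓ _)
    (trans (cong (node ℓ) (Q.class-cong (toℕ ℓ) f≈f′)) (sym (target-node ℓ _)))

  node-target : ∀ {k} ℓ a → toℕ ℓ ≡ k → target k (Q.representative (toℕ ℓ) a) ≡ node ℓ a
  node-target ℓ a refl = trans (target-node ℓ _) (cong (node ℓ) (Q.class-representative (toℕ ℓ) a))

  -- On the first level all colorings are equivalent, since `mix 0` ignores the prefix, so the root
  -- is the only node there. On a later level the predecessor is the class of the same
  -- representative `f` one level earlier, and the arc is the letter that `f` has there.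
  root-unique : ∀ ℓ a → node ℓ a ≢ target 0 blank → ∃[ ℓ′ ] ∃[ a′ ] ∃[ j ] arc ℓ′ a′ j ≡ node ℓ a
  root-unique ℓ a ≢root = predecessor (toℕ ℓ) refl
    where
    f = Q.representative (toℕ ℓ) a
    predecessor : ∀ k → toℕ ℓ ≡ k → ∃[ ℓ′ ] ∃[ a′ ] ∃[ j ] arc ℓ′ a′ j ≡ node ℓ a
    predecessor zero    ℓ≡0   = contradiction
      (trans (sym (node-target ℓ a ℓ≡0)) (target-cong ℓ ℓ≡0 λ g →
        subst (λ h → Accept h ⇔ Accept (mix 0 blank g))
              (trans (mix-none blank g) (sym (mix-none f g))) ⇔.refl)) ≢root
    predecessor (suc k) ℓ≡1+k = ℓ′ , Q.class (toℕ ℓ′) f , Vec.lookup f ℓ′ ,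
      trans (target-cong ℓ ℓ≡1+ℓ′ (λ g → ⇔.sym (step-back g)))
            (node-target ℓ a ℓ≡1+ℓ′)
      where
      k<m    = ℕ.<-trans (ℕ.≤-reflexive (sym ℓ≡1+k)) (Fin.toℕ<n ℓ)
      ℓ′     = fromℕ< k<m
      ℓ≡1+ℓ′ : toℕ ℓ ≡ suc (toℕ ℓ′)
      ℓ≡1+ℓ′ = trans ℓ≡1+k (cong suc (sym (Fin.toℕ-fromℕ< k<m)))
      f′     = Q.representative (toℕ ℓ′) (Q.class (toℕ ℓ′) f) [ ℓ′ ]≔ Vec.lookup f ℓ′
      step-back : Residual≈ (suc (toℕ ℓ′)) f f′
      step-back = subst (λ x → Residual≈ (suc (toℕ ℓ′)) x f′) (Vec.[]≔-lookup f ℓ′)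
        (residual≈-step ℓ′ (Vec.lookup f ℓ′) {f} (Q.≈-representative (toℕ ℓ′) f))

  diagram : DD c m
  diagram = record
    { size        = size
    ; root        = target 0 blank
    ; arc         = arc
    ; arc-label   = target-label _ _
    ; root-unique = root-unique
    }

  open DD diagram using (PathToTop; done; step; UsesArc; here; there; Represents)

  Traces : ∀ {α} → ℕ → Coloring c m → PathToTop α → Set
  Traces k h p = ∀ e j → UsesArc j e p ⇔ (k ≤ toℕ e × Vec.lookup h e ≡ j)

  traces-step : ∀ {ℓ a j} h (p : PathToTop (arc ℓ a j)) → Vec.lookup h ℓ ≡ j →
                Traces (suc (toℕ ℓ)) h p → Traces (toℕ ℓ) h (step {ℓ} {a} j p)
  traces-step {ℓ} {a} {i} h p hℓ≡i tr e j = mk⇔ to′ from′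
    where
    to′ : UsesArc j e (step {ℓ} {a} i p) → toℕ ℓ ≤ toℕ e × Vec.lookup h e ≡ j
    to′ here      = ℕ.≤-refl , hℓ≡i
    to′ (there u) with ℓ<e , eq ← to (tr e j) u = ℕ.<⇒≤ ℓ<e , eq

    from′ : toℕ ℓ ≤ toℕ e × Vec.lookup h e ≡ j → UsesArc j e (step {ℓ} {a} i p)
    from′ (ℓ≤e , he≡j) with ℕ.m≤n⇒m<n∨m≡n ℓ≤e
    ... | inj₁ ℓ<e = there (from (tr e j) (ℓ<e , he≡j))
    ... | inj₂ ℓ≡e with refl ← Fin.toℕ-injective ℓ≡e with refl ← trans (sym hℓ≡i) he≡j = here

  traces-done : ∀ {k} h → m ≤ k → Traces k h done
  traces-done h m≤k e j = mk⇔ (λ ()) λ (k≤e , _) → contradiction (ℕ.≤-trans m≤k k≤e) (ℕ.<⇒≱ (Fin.toℕ<n e))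

  -- `d` is fuel for the levels that remain. The invariant is that `h` completes the current prefix
  -- to an accepted coloring; it survives the replacement of the prefix by the representative of its
  -- class.
  path : ∀ d k f h → m ≤ d + k → Accept (mix k f h) → ∃[ p ] Traces {target k f} k h p
  path d k f h m≤d+k acc with k ℕ.<? m
  path d k f h m≤d+k acc | no k≮m with accept? f
  ... | yes _   = done , traces-done h (ℕ.≮⇒≥ k≮m)
  ... | no ¬acc = contradiction (subst Accept (mix-all f h (ℕ.≮⇒≥ k≮m)) acc) ¬acc
  path zero k f h m≤k acc | yes k<m = contradiction m≤k (ℕ.<⇒≱ k<m)
  path (suc d) k f h m≤d+k acc | yes k<m = extend (fromℕ< k<m) (Fin.toℕ-fromℕ< k<m)
    where
    extend : ∀ ℓ → toℕ ℓ ≡ k → ∃[ p ] Traces {node ℓ (Q.class (toℕ ℓ) f)} k h p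
    extend ℓ refl
      with p , tr ← path d (suc k) (Q.representative k (Q.class k f) [ ℓ ]≔ Vec.lookup h ℓ) h
                      (subst (m ≤_) (sym (ℕ.+-suc d k)) m≤d+k)
                      (subst Accept (sym (mix-step ℓ _ h)) (to (Q.≈-representative k f h) acc))
      = step (Vec.lookup h ℓ) p , traces-step h p refl tr

  traced : ∀ k f (p : PathToTop (target k f)) → ∃[ h ] (Accept (mix k f h) × Traces k h p)
  traced k f p with k ℕ.<? m
  traced k f p | no k≮m with accept? f
  -- No position is left, so any coloring can start the construction; the enclosing calls write the
  -- letters of the path into it.
  traced k f done | no k≮m | yes acc =
    blank , subst Accept (sym (mix-all f blank (ℕ.≮⇒≥ k≮m))) acc , traces-done blank (ℕ.≮⇒≥ k≮m)
  traced k f (step j p) | yes k<m = extend (fromℕ< k<m) (Fin.toℕ-fromℕ< k<m) j p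
    where
    extend : ∀ ℓ → toℕ ℓ ≡ k → ∀ j p → ∃[ h ] (Accept (mix k f h) × Traces k h (step {ℓ} {Q.class (toℕ ℓ) f} j p))
    extend ℓ refl j p
      with h , acc , tr ← traced (suc k) (Q.representative k (Q.class k f) [ ℓ ]≔ j) p
      = h [ ℓ ]≔ j
      , from (Q.≈-representative k f (h [ ℓ ]≔ j)) (subst Accept (mix-update ℓ j _ h) acc)
      , traces-step (h [ ℓ ]≔ j) p (Vec.lookup∘update ℓ h j) λ e i → mk⇔
          (λ u → let ℓ<e , he≡i = to (tr e i) u in ℓ<e , trans (beyond ℓ<e) he≡i)
          (λ (ℓ<e , eq) → from (tr e i) (ℓ<e , trans (sym (beyond ℓ<e)) eq))
      where
      beyond : ∀ {e} → toℕ ℓ < toℕ e → Vec.lookup (h [ ℓ ]≔ j) e ≡ Vec.lookup h e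
      beyond ℓ<e = Vec.lookup∘update′ (λ e≡ℓ → ℕ.<-irrefl (cong toℕ (sym e≡ℓ)) ℓ<e) h j

  represents : ∀ {𝓕 : ColoredSubset c m → Set} → (∀ h B → Colors h B → 𝓕 B ⇔ Accept h) → Represents 𝓕
  represents 𝓕⇔Accept B = mk⇔
    (λ (p , rep) → let h , acc , tr = traced 0 blank p in
       from (𝓕⇔Accept h B λ j e → ⇔.trans (rep j e) (⇔.trans (tr e (suc j)) (mk⇔ proj₂ (z≤n ,_))))
            (subst Accept (mix-none blank h) acc))
    (λ B∈𝓕 → let h = coloringOf B
                 p , tr = path m 0 blank h (ℕ.m≤m+n m 0)
                   (subst Accept (sym (mix-none blank h)) (to (𝓕⇔Accept h B (colors-coloringOf B)) B∈𝓕)) in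
       p , λ j e → ⇔.trans (colors-coloringOf B j e) (⇔.trans (mk⇔ (z≤n ,_) proj₂) (⇔.sym (tr e (suc j)))))

  Live : ℕ → Coloring c m → Set
  Live k f = ∃[ g ] Accept (mix k f g)

  live? : ∀ k → Decidable (Live k)
  live? k f = map′ Any.satisfied (λ (g , acc) → lose (∈-vectors g) acc)
    (Any.any? (λ g → accept? (mix k f g)) (vectors (suc c) m))

  -- All dead prefixes form a single class.
  size-bound : ∀ ℓ {N} (key : ∀ f → Live (toℕ ℓ) f → Fin N) →
    (∀ f f′ l l′ → key f l ≡ key f′ l′ → Residual≈ (toℕ ℓ) f f′) → size ℓ ≤ suc N
  size-bound ℓ {N} key key-injective = Fin.injective⇒≤ {f = λ a → code (live? (toℕ ℓ) (rep a))}
    λ {a} {b} eq → Q.representative-injective (toℕ ℓ) a b (code-injective (live? _ _) (live? _ _) eq)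
    where
    rep = Q.representative (toℕ ℓ)

    code : ∀ {f} → Dec (Live (toℕ ℓ) f) → Fin (suc N)
    code (yes l) = suc (key _ l)
    code (no _)  = zero

    code-injective : ∀ {f f′} (l : Dec (Live (toℕ ℓ) f)) (l′ : Dec (Live (toℕ ℓ) f′)) →
                     code l ≡ code l′ → Residual≈ (toℕ ℓ) f f′
    code-injective (yes l) (yes l′) eq = key-injective _ _ l l′ (Fin.suc-injective eq)
    code-injective (no ¬l) (no ¬l′) eq g =
      mk⇔ (λ acc → contradiction (g , acc) ¬l) (λ acc → contradiction (g , acc) ¬l′)

-- Counting the elements that satisfy a decidable predicate

#_ : ∀ {n} {P : Pred (Fin n) 0ℓ} → Decidable P → ℕ
# P? = ∣ comprehension P? ∣

#-mono : ∀ {n} {P Q : Pred (Fin n) 0ℓ} (P? : Decidable P) (Q? : Decidable Q) →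
         (∀ x → P x → Q x) → # P? ≤ # Q?
#-mono P? Q? P⊆Q = p⊆q⇒∣p∣≤∣q∣ λ x∈ → from (∈-comprehension Q?) (P⊆Q _ (to (∈-comprehension P?) x∈))

#-cong : ∀ {n} {P Q : Pred (Fin n) 0ℓ} (P? : Decidable P) (Q? : Decidable Q) →
         (∀ x → P x ⇔ Q x) → # P? ≡ # Q?
#-cong P? Q? P⇔Q = ℕ.≤-antisym (#-mono P? Q? (to ∘ P⇔Q)) (#-mono Q? P? (from ∘ P⇔Q))

#-split : ∀ {n} {P R : Pred (Fin n) 0ℓ} (P? : Decidable P) (R? : Decidable R) →
          # P? ≡ # (λ x → P? x ×-dec R? x) + # (λ x → P? x ×-dec ¬? (R? x))
#-split {zero}  P? R? = refl
#-split {suc n} P? R? with ih ← #-split (P? ∘ suc) (R? ∘ suc) | P? zero | R? zero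
... | yes _ | yes _ = cong suc ih
... | yes _ | no _  = trans (cong suc ih) (sym (ℕ.+-suc _ _))
... | no _  | _     = ih

∣p∣>0⇒nonempty : ∀ {n} (p : Subset n) → 0 < ∣ p ∣ → ∃[ x ] x Subset.∈ p
∣p∣>0⇒nonempty (inside  ∷ p) _ = zero , Vec.here
∣p∣>0⇒nonempty (outside ∷ p) 0<∣p∣ with x , x∈p ← ∣p∣>0⇒nonempty p 0<∣p∣ = suc x , Vec.there x∈p

nonempty⇒∣p∣>0 : ∀ {n} {p : Subset n} {x} → x Subset.∈ p → 0 < ∣ p ∣
nonempty⇒∣p∣>0 Vec.here = s≤s z≤n
nonempty⇒∣p∣>0 {p = inside  ∷ p} (Vec.there x∈p) = s≤s z≤n
nonempty⇒∣p∣>0 {p = outside ∷ p} (Vec.there x∈p) = nonempty⇒∣p∣>0 x∈p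

#>0 : ∀ {n} {P : Pred (Fin n) 0ℓ} (P? : Decidable P) → 0 < # P? ⇔ ∃ P
#>0 P? = mk⇔
  (λ 0<# → let x , x∈ = ∣p∣>0⇒nonempty (comprehension P?) 0<# in x , to (∈-comprehension P?) x∈)
  (λ (x , Px) → nonempty⇒∣p∣>0 (from (∈-comprehension P?) Px))

length-filter-tabulate : ∀ {A : Set} {n} {P : Pred A 0ℓ} (P? : Decidable P) (f : Fin n → A) →
                         length (filter P? (List.tabulate f)) ≡ # (P? ∘ f)
length-filter-tabulate {n = zero}  P? f = refl
length-filter-tabulate {n = suc n} P? f with P? (f zero)
... | yes _ = cong suc (length-filter-tabulate P? (f ∘ suc))
... | no  _ = length-filter-tabulate P? (f ∘ suc)

length-filter-map-filter : ∀ {A B : Set} {P : Pred B 0ℓ} {Q : Pred A 0ℓ}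
  (P? : Decidable P) (Q? : Decidable Q) (f : A → B) xs →
  length (filter P? (map f (filter Q? xs))) ≡ length (filter (λ x → P? (f x) ×-dec Q? x) xs)
length-filter-map-filter P? Q? f [] = refl
length-filter-map-filter P? Q? f (x ∷ xs) with ih ← length-filter-map-filter P? Q? f xs | Q? x
... | no  _ with P? (f x)
...   | yes _ = ih
...   | no  _ = ih
length-filter-map-filter P? Q? f (x ∷ xs) | yes _ with P? (f x)
...   | yes _ = cong suc ih
...   | no  _ = ih

-- Multisets of colored degrees

module _ {c : ℕ} where
  open import Data.List.Membership.DecPropositional (_≟ᵈ_ {c}) public using () renaming (_∈?_ to _∈ᵈ?_)

  private
    Degrees = List (ColoredDegree c)

  multiplicity-++ : ∀ (s r : Degrees) δ → multiplicity (s ++ r) δ ≡ multiplicity s δ + multiplicity r δ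
  multiplicity-++ s r δ = trans (cong length (filter-++ (δ ≟ᵈ_) s r)) (length-++ (filter (δ ≟ᵈ_) s))

  multiplicity-↭ : ∀ {s r : Degrees} → s ↭ r → ∀ δ → multiplicity s δ ≡ multiplicity r δ
  multiplicity-↭ s↭r δ = ↭-length (filter-↭ (δ ≟ᵈ_) s↭r)

  multiplicity-∉ : ∀ {s : Degrees} {δ} → δ ∉ s → multiplicity s δ ≡ 0
  multiplicity-∉ {s} {δ} δ∉s = cong length (filter-none (δ ≟ᵈ_) (¬Any⇒All¬ s δ∉s))

  multiplicity-∈ : ∀ {s : Degrees} {δ} → δ ∈ s → 0 < multiplicity s δ
  multiplicity-∈ {δ = δ} δ∈s = ∈-length (∈-filter⁺ (δ ≟ᵈ_) δ∈s refl)

  multiplicity>0 : ∀ {s : Degrees} {δ} → 0 < multiplicity s δ → δ ∈ s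
  multiplicity>0 {s} {δ} 0<s with δ ∈ᵈ? s
  ... | yes δ∈s = δ∈s
  ... | no  δ∉s = contradiction (multiplicity-∉ δ∉s) (ℕ.>⇒≢ 0<s)

  -- The degree condition of the constraint, expressed by counts alone. It makes sense for any
  -- function `N`, so it applies to vertex counts without a list of degrees; `split⇒extends` and
  -- `extends⇒split` link it to the existence of a remainder.
  Extends : Degrees → Degrees → (ColoredDegree c → ℕ) → Set
  Extends s t N = ∀ δ → multiplicity s δ ≤ N δ × (δ ∈ t ⊎ N δ ≤ multiplicity s δ)

  split⇒extends : ∀ {s t r xs : Degrees} → All (_∈ t) r → xs ↭ s ++ r → Extends s t (multiplicity xs)
  split⇒extends {s} {t} {r} r⊆t xs↭ δ
    rewrite multiplicity-↭ xs↭ δ | multiplicity-++ s r δ = ℕ.m≤m+n _ _ , excess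
    where
    excess : δ ∈ t ⊎ multiplicity s δ + multiplicity r δ ≤ multiplicity s δ
    excess with δ ∈ᵈ? r
    ... | yes δ∈r = inj₁ (All.lookup r⊆t δ∈r)
    ... | no  δ∉r rewrite multiplicity-∉ δ∉r = inj₂ (ℕ.≤-reflexive (ℕ.+-identityʳ _))

  extends-tail : ∀ {x} {s t xs : Degrees} → Extends (x ∷ s) t (multiplicity (x ∷ xs)) →
                 Extends s t (multiplicity xs)
  extends-tail {x} ext δ with ext δ
  ... | h with δ ≟ᵈ x
  ...   | no  _ = h
  ...   | yes _ with h
  ...     | lower , inj₁ δ∈t   = s≤s⁻¹ lower , inj₁ δ∈t
  ...     | lower , inj₂ upper = s≤s⁻¹ lower , inj₂ (s≤s⁻¹ upper)

  extends-↭ : ∀ {s t xs ys : Degrees} → xs ↭ ys → Extends s t (multiplicity xs) → Extends s t (multiplicity ys)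
  extends-↭ {s} {t} xs↭ys ext δ =
    subst (λ k → multiplicity s δ ≤ k × (δ ∈ t ⊎ k ≤ multiplicity s δ)) (multiplicity-↭ xs↭ys δ) (ext δ)

  -- The head of `s` has positive multiplicity in `xs`, so an occurrence can be moved to the front
  -- and cancelled on both sides. Once `s` is exhausted, everything left has positive count against
  -- multiplicity 0 and must come from `t`.
  extends⇒split : ∀ (s : Degrees) {t xs} → Extends s t (multiplicity xs) →
                  ∃[ r ] (All (_∈ t) r × xs ↭ s ++ r)
  extends⇒split [] {t} {xs} ext = xs , All.tabulate (λ {δ} δ∈xs → inT δ∈xs (proj₂ (ext δ))) , ↭-refl
    where
    inT : ∀ {δ} → δ ∈ xs → δ ∈ t ⊎ multiplicity xs δ ≤ 0 → δ ∈ t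
    inT δ∈xs (inj₁ δ∈t) = δ∈t
    inT δ∈xs (inj₂ ≤0)  = contradiction ≤0 (ℕ.<⇒≱ (multiplicity-∈ δ∈xs))
  extends⇒split (x ∷ s) {t} {xs} ext
    with ys , zs , refl ← ∈-∃++ (multiplicity>0 {s = xs}
           (ℕ.<-≤-trans (multiplicity-∈ {s = x ∷ s} (here refl)) (proj₁ (ext x))))
    with r , r⊆t , rest↭ ← extends⇒split s {t} {ys ++ zs}
           (extends-tail {s = s} {xs = ys ++ zs}
             (extends-↭ {s = x ∷ s} {xs = ys ++ x ∷ zs} (shift x ys zs) ext))
    = r , r⊆t , ↭-trans (shift x ys zs) (prep x rest↭)

-- Reachability

module _ {n : ℕ} where

  -- Union-find: the value at `x` is a representative of the component of `x` in the graph with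
  -- edges `ps`, and each pair redirects the representative of `u` to that of `v`. Comparing values
  -- decides reachability without any bound on path lengths.
  merge : List (Fin n × Fin n) → Fin n → Fin n
  merge []             x = x
  merge ((u , v) ∷ ps) x = if does (merge ps x Fin.≟ merge ps u) then merge ps v else merge ps x

  merge-∈ : ∀ {ps u v} → (u , v) ∈ ps → merge ps u ≡ merge ps v
  merge-∈ {(u , v) ∷ ps} (here refl)
    rewrite dec-true (merge ps u Fin.≟ merge ps u) refl with merge ps v Fin.≟ merge ps u
  ... | yes _ = refl
  ... | no  _ = refl
  merge-∈ {(u , v) ∷ ps} (there x∈) =
    cong (λ x → if does (x Fin.≟ merge ps u) then merge ps v else x) (merge-∈ x∈)

  module _ {R : Rel (Fin n) 0ℓ} (sym-R : Symmetric R) where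

    star-merge : ∀ {ps} → All (uncurry R) ps → ∀ x → Star R x (merge ps x)
    star-merge []                          x = ε
    star-merge {(u , v) ∷ ps} (Ruv ∷ Rps) x with merge ps x Fin.≟ merge ps u
    ... | yes x~u =
      subst (Star R x) x~u (star-merge Rps x) ◅◅
      reverse sym-R (star-merge Rps u) ◅◅ Ruv ◅ star-merge Rps v
    ... | no  _   = star-merge Rps x

    star? : Binary.Decidable R → Binary.Decidable (Star R)
    star? R? x y = map′ sound complete (merge ps x Fin.≟ merge ps y)
      where
      R?′ = λ (u , v) → R? u v
      ps  = filter R?′ (cartesianProduct (allFin n) (allFin n))

      Rps : All (uncurry R) ps
      Rps = all-filter R?′ (cartesianProduct (allFin n) (allFin n))

      sound : ∀ {x y} → merge ps x ≡ merge ps y → Star R x y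
      sound {x} {y} eq = subst (Star R x) eq (star-merge Rps x) ◅◅ reverse sym-R (star-merge Rps y)

      complete : ∀ {x y} → Star R x y → merge ps x ≡ merge ps y
      complete ε            = refl
      complete (Rxz ◅ path) = trans
        (merge-∈ (∈-filter⁺ R?′ (∈-cartesianProduct⁺ (∈-allFin _) (∈-allFin _)) Rxz)) (complete path)

-- Connectivity of a union of past and future edges across the frontier

module Connectivity (G : Graph) where
  open Graph G

  Touched : Pred (Fin m) 0ℓ → Pred (Fin n) 0ℓ
  Touched S u = ∃[ e ] (S e × u Subset.∈ edge e)

  Adjacent : Pred (Fin m) 0ℓ → Rel (Fin n) 0ℓ
  Adjacent S u v = ∃[ e ] (S e × u Subset.∈ edge e × v Subset.∈ edge e)

  Reach : Pred (Fin m) 0ℓ → Rel (Fin n) 0ℓ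
  Reach S = Star (Adjacent S)

  Connected : Pred (Fin m) 0ℓ → Set
  Connected S = ∀ u v → Touched S u → Touched S v → Reach S u v

  adjacent-sym : ∀ {S} → Symmetric (Adjacent S)
  adjacent-sym (e , Se , u∈e , v∈e) = e , Se , v∈e , u∈e

  reach-sym : ∀ {S} → Symmetric (Reach S)
  reach-sym = reverse adjacent-sym

  adjacent-mono : ∀ {S T : Pred (Fin m) 0ℓ} → (∀ {e} → S e → T e) → ∀ {u v} → Adjacent S u v → Adjacent T u v
  adjacent-mono S⊆T (e , Se , uv) = e , S⊆T Se , uv

  reach-mono : ∀ {S T : Pred (Fin m) 0ℓ} → (∀ {e} → S e → T e) → ∀ {u v} → Reach S u v → Reach T u v
  reach-mono S⊆T = Star.map (adjacent-mono S⊆T)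

  touched-mono : ∀ {S T : Pred (Fin m) 0ℓ} → (∀ {e} → S e → T e) → ∀ {u} → Touched S u → Touched T u
  touched-mono S⊆T (e , Se , u∈e) = e , S⊆T Se , u∈e

  connected-cong : ∀ {S T : Pred (Fin m) 0ℓ} → (∀ e → S e ⇔ T e) → Connected S → Connected T
  connected-cong S⇔T conn u v tu tv = reach-mono (to (S⇔T _))
    (conn u v (touched-mono (from (S⇔T _)) tu) (touched-mono (from (S⇔T _)) tv))

  module _ {S : Pred (Fin m) 0ℓ} (S? : Decidable S) where

    touched? : Decidable (Touched S)
    touched? u = Fin.any? λ e → S? e ×-dec (u ∈? edge e)

    reach? : Binary.Decidable (Reach S)
    reach? = star? adjacent-sym λ u v → Fin.any? λ e → S? e ×-dec ((u ∈? edge e) ×-dec (v ∈? edge e))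

    connected? : Dec (Connected S)
    connected? = Fin.all? λ u → Fin.all? λ v → touched? u →-dec (touched? v →-dec reach? u v)

  reach-touched : ∀ {S u v} → Reach S u v → u ≡ v ⊎ (Touched S u × Touched S v)
  reach-touched ε = inj₁ refl
  reach-touched ((e , Se , u∈e , w∈e) ◅ path) with reach-touched path
  ... | inj₁ refl        = inj₂ ((e , Se , u∈e) , (e , Se , w∈e))
  ... | inj₂ (_ , tv)    = inj₂ ((e , Se , u∈e) , tv)

  -- A component of the prefix that avoids the frontier can never grow.
  HasClosedComponent : Pred (Fin m) 0ℓ → Pred (Fin n) 0ℓ → Set
  HasClosedComponent P F = ∃[ x ] (Touched P x × ¬ (∃[ y ] (F y × Reach P x y)))

  hasClosedComponent? : ∀ {P F} → Decidable P → Decidable F → Dec (HasClosedComponent P F)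
  hasClosedComponent? P? F? = Fin.any? λ x →
    touched? P? x ×-dec ¬? (Fin.any? λ y → F? y ×-dec reach? P? x y)

  _∪ₚ_ : Pred (Fin m) 0ℓ → Pred (Fin m) 0ℓ → Pred (Fin m) 0ℓ
  (P ∪ₚ Q) e = P e ⊎ Q e

  Separates : Pred (Fin n) 0ℓ → Pred (Fin m) 0ℓ → Pred (Fin m) 0ℓ → Set
  Separates F P Q = ∀ {u} → Touched P u → Touched Q u → F u

  -- Connectivity would give a path from the closed component to an endpoint of the remaining edge
  -- `e`. The path can leave the component only by an edge of `Q`, hence at a frontier vertex, and
  -- the component has none. So that endpoint lies in the component and also meets `e`, which puts
  -- it in the frontier after all.
  closed⇒finished : ∀ {F P Q} → Separates F P Q → HasClosedComponent P F → Connected (P ∪ₚ Q) →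
                    ∀ e → ∃ (Subset._∈ edge e) → ¬ Q e
  closed⇒finished {F} {P} {Q} sep (x , tx , closed) conn e (y , y∈e) Qe =
    let path = stays (conn x y (touched-mono inj₁ tx) (e , inj₂ Qe , y∈e)) tx ε in
    closed (y , sep (proj₁ path) (e , Qe , y∈e) , proj₂ path)
    where
    stays : ∀ {u v} → Reach (P ∪ₚ Q) u v → Touched P u → Reach P x u → Touched P v × Reach P x v
    stays ε tu xu = tu , xu
    stays ((e , inj₁ Pe , u∈e , w∈e) ◅ path) tu xu = stays path (e , Pe , w∈e) (xu ◅◅ (e , Pe , u∈e , w∈e) ◅ ε)
    stays ((e , inj₂ Qe , u∈e , w∈e) ◅ path) tu xu = contradiction (_ , sep tu (e , Qe , u∈e) , xu) closed

  module _ {F : Pred (Fin n) 0ℓ} {P P′ Q Q′ : Pred (Fin m) 0ℓ}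
    (F? : Decidable F) (P′? : Decidable P′)
    (nonempty : ∀ e → ∃ (Subset._∈ edge e))
    (sep : Separates F P Q) (sep′ : Separates F P′ Q′)
    (touched⇔ : ∀ {u} → F u → Touched P u ⇔ Touched P′ u)
    (reach⇒ : ∀ {u v} → F u → F v → Reach P u v → Reach P′ u v)
    (closed⇔ : HasClosedComponent P F ⇔ HasClosedComponent P′ F)
    where

    private
      Boundary : Pred (Fin n) 0ℓ
      Boundary u = F u ⊎ Touched Q u

      -- A boundary vertex outside the frontier meets no edge of `P`, so only the trivial path
      -- starts or ends there. All other paths join frontier vertices, where `reach⇒` applies.
      boundary-reach : ∀ {u v} → Boundary u → Boundary v → Reach P u v → Reach P′ u v
      boundary-reach bu bv uv with reach-touched uv
      ... | inj₁ refl      = ε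
      ... | inj₂ (tu , tv) = reach⇒ (inF bu tu) (inF bv tv) uv
        where
        inF : ∀ {w} → Boundary w → Touched P w → F w
        inF (inj₁ Fw) _  = Fw
        inF (inj₂ tQ) tP = sep tP tQ

      -- The path is cut at its Q-edges, whose endpoints are boundary vertices.
      transfer : ∀ {u b z v} → Boundary b → Boundary v → Reach (P′ ∪ₚ Q) u b → Reach P b z →
                 Reach (P ∪ₚ Q) z v → Reach (P′ ∪ₚ Q) u v
      transfer bb bv ub bz ε = ub ◅◅ reach-mono inj₁ (boundary-reach bb bv bz)
      transfer bb bv ub bz ((e , inj₁ Pe , z∈e , w∈e) ◅ path) =
        transfer bb bv ub (bz ◅◅ (e , Pe , z∈e , w∈e) ◅ ε) path
      transfer bb bv ub bz ((e , inj₂ Qe , z∈e , w∈e) ◅ path) =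
        transfer (inj₂ (e , Qe , w∈e)) bv
          (ub ◅◅ reach-mono inj₁ (boundary-reach bb (inj₂ (e , Qe , z∈e)) bz) ◅◅
           (e , inj₂ Qe , z∈e , w∈e) ◅ ε) ε path

      -- Without a closed component every vertex met by `P′` reaches the frontier inside `P′`. By
      -- `touched⇔` the frontier vertex found is met by `P` as well, so connectedness of `P ∪ₚ Q`
      -- can be applied to it.
      anchor : ¬ HasClosedComponent P′ F → ∀ {u} → Touched (P′ ∪ₚ Q) u →
               ∃[ b ] (Boundary b × Touched (P ∪ₚ Q) b × Reach (P′ ∪ₚ Q) u b)
      anchor open′ (e , inj₂ Qe , u∈e) = _ , inj₂ (e , Qe , u∈e) , (e , inj₂ Qe , u∈e) , ε
      anchor open′ {u} (e , inj₁ P′e , u∈e) with Fin.any? (λ y → F? y ×-dec reach? P′? u y)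
      ... | no ∄          = contradiction (u , (e , P′e , u∈e) , ∄) open′
      ... | yes (b , Fb , ub) = b , inj₁ Fb , touched-mono inj₁ (from (touched⇔ Fb) tb) , reach-mono inj₁ ub
        where
        tb : Touched P′ b
        tb with reach-touched ub
        ... | inj₁ refl     = e , P′e , u∈e
        ... | inj₂ (_ , tb) = tb

    -- If `P′` has a closed component, so has `P`; then neither `Q` nor `Q′` contains an edge and
    -- `conn′` is already the claim. Otherwise every touched vertex is joined to a boundary vertex
    -- by `anchor`, and `transfer` carries paths between boundary vertices over from `P` to `P′`.
    exchange : Connected (P ∪ₚ Q) → Connected (P′ ∪ₚ Q′) → Connected (P′ ∪ₚ Q)
    exchange conn conn′ with hasClosedComponent? P′? F?
    ... | yes closed = connected-cong (λ e → mk⇔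
            (λ { (inj₁ P′e) → inj₁ P′e ; (inj₂ Q′e) →
                contradiction Q′e (closed⇒finished sep′ closed conn′ e (nonempty e)) })
            (λ { (inj₁ P′e) → inj₁ P′e ; (inj₂ Qe) →
                contradiction Qe (closed⇒finished sep (from closed⇔ closed) conn e (nonempty e)) }))
          conn′
    ... | no open′ = λ u v tu tv →
      let a , ba , ta , ua = anchor open′ tu
          b , bb , tb , vb = anchor open′ tv
      in transfer ba bb ua ε (conn a b ta tb) ◅◅ reach-sym vb

-- Injective codes in finite sets, and exchange of capped counts

enumerate : ∀ {n} (p : Subset n) → Fin ∣ p ∣ → Fin n
enumerate (inside  ∷ p) zero    = zero
enumerate (inside  ∷ p) (suc i) = suc (enumerate p i)
enumerate (outside ∷ p) i       = suc (enumerate p i)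

enumerate-∈ : ∀ {n} (p : Subset n) i → enumerate p i Subset.∈ p
enumerate-∈ (inside  ∷ p) zero    = Vec.here
enumerate-∈ (inside  ∷ p) (suc i) = Vec.there (enumerate-∈ p i)
enumerate-∈ (outside ∷ p) i       = Vec.there (enumerate-∈ p i)

enumerate-surjective : ∀ {n} {p : Subset n} {x} → x Subset.∈ p → ∃[ i ] enumerate p i ≡ x
enumerate-surjective Vec.here = zero , refl
enumerate-surjective {p = inside  ∷ p} (Vec.there x∈p) with i , refl ← enumerate-surjective x∈p = suc i , refl
enumerate-surjective {p = outside ∷ p} (Vec.there x∈p) with i , refl ← enumerate-surjective x∈p = i , refl

funToFin-injective : ∀ {m n} {f g : Fin m → Fin n} → funToFin f ≡ funToFin g → ∀ i → f i ≡ g i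
funToFin-injective {f = f} {g} eq i =
  trans (sym (Fin.finToFun-funToFin f i)) (trans (cong (λ x → Fin.finToFun x i) eq) (Fin.finToFun-funToFin g i))

module _ {A : Set} {k : A → ℕ} where

  tupleToFin : (∀ x → Fin (k x)) → ∀ xs → Fin (product (map k xs))
  tupleToFin f []       = zero
  tupleToFin f (x ∷ xs) = combine (f x) (tupleToFin f xs)

  tupleToFin-injective : ∀ {f g : ∀ x → Fin (k x)} xs → tupleToFin f xs ≡ tupleToFin g xs →
                         ∀ {x} → x ∈ xs → f x ≡ g x
  tupleToFin-injective {f} {g} (x ∷ xs) eq x∈
    with fx≡gx , rest ← Fin.combine-injective (f x) (tupleToFin f xs) (g x) (tupleToFin g xs) eq | x∈
  ... | here refl = fx≡gx
  ... | there x∈′ = tupleToFin-injective {f} {g} xs rest x∈′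

decToFin : {A : Set} → Dec A → Fin 2
decToFin (yes _) = zero
decToFin (no _)  = suc zero

decToFin-injective : {A B : Set} (a? : Dec A) (b? : Dec B) → decToFin a? ≡ decToFin b? → A ⇔ B
decToFin-injective (yes a) (yes b) _ = mk⇔ (λ _ → b) (λ _ → a)
decToFin-injective (no ¬a) (no ¬b) _ = mk⇔ (λ a → contradiction a ¬a) (λ b → contradiction b ¬b)

-- For a degree δ, `A` and `A′` count the closed vertices of two prefixes, `B` and `B′` the other
-- vertices under their completions, `S` is the multiplicity of δ in `s`, and `T` says that δ lies
-- in `t`. Below the cap, `A` and `A′` agree. At the cap the lower bound already holds; if δ is not
-- in `t`, the second completion forces `A′ ≤ S ≤ A`, and the upper bound for `A + B` passes to
-- `A′ + B`.
capped-exchange : ∀ {T : Set} {A A′ B B′ S} →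
                  A ⊓ S ≡ A′ ⊓ S → S ≤ A + B → T ⊎ A + B ≤ S → T ⊎ A′ + B′ ≤ S →
                  S ≤ A′ + B × (T ⊎ A′ + B ≤ S)
capped-exchange {T} {A} {A′} {B} {B′} {S} eq lower upper upper′ with ℕ.≤-total A S | ℕ.≤-total A′ S
... | inj₁ A≤S | inj₁ A′≤S
  with refl ← trans (sym (ℕ.m≤n⇒m⊓n≡m A≤S)) (trans eq (ℕ.m≤n⇒m⊓n≡m A′≤S)) = lower , upper
... | inj₂ S≤A | inj₁ A′≤S
  with refl ← trans (sym (ℕ.m≥n⇒m⊓n≡n S≤A)) (trans eq (ℕ.m≤n⇒m⊓n≡m A′≤S)) =
  ℕ.m≤m+n S B , Sum.map₂ (ℕ.≤-trans (ℕ.+-monoˡ-≤ B S≤A)) upper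
... | _ | inj₂ S≤A′ = ℕ.≤-trans S≤A′ (ℕ.m≤m+n A′ B) , excess upper upper′
  where
  S≤A : S ≤ A
  S≤A = ℕ.≤-trans (ℕ.≤-reflexive (trans (sym (ℕ.m≥n⇒m⊓n≡n S≤A′)) (sym eq))) (ℕ.m⊓n≤m A S)
  excess : T ⊎ A + B ≤ S → T ⊎ A′ + B′ ≤ S → T ⊎ A′ + B ≤ S
  excess (inj₁ t) _ = inj₁ t
  excess _ (inj₁ t) = inj₁ t
  excess (inj₂ A+B≤S) (inj₂ A′+B′≤S) =
    inj₂ (ℕ.≤-trans (ℕ.+-monoˡ-≤ B (ℕ.≤-trans (ℕ.m+n≤o⇒m≤o A′ A′+B′≤S) S≤A)) A+B≤S)

-- Colored subgraphs as accepted colorings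

𝟘 : ∀ {c} → ColoredDegree c
𝟘 = Vec.replicate _ 0

𝟘-≼ : ∀ {c} (δ : ColoredDegree c) → 𝟘 ≼ δ
𝟘-≼ []      = []
𝟘-≼ (_ ∷ δ) = z≤n ∷ 𝟘-≼ δ

module Subgraphs (G : Graph) {c : ℕ} (s t : List (ColoredDegree c)) where
  open Graph G
  open Connectivity G

  edge-nonempty : ∀ e → ∃[ u ] u Subset.∈ edge e
  edge-nonempty e = ∣p∣>0⇒nonempty (edge e) (subst (0 <_) (sym (edge-size e)) (s≤s z≤n))

  ColorClass : Fin c → Coloring c m → Pred (Fin m) 0ℓ
  ColorClass i h e = Vec.lookup h e ≡ suc i

  colorClass? : ∀ i h → Decidable (ColorClass i h)
  colorClass? i h e = Vec.lookup h e Fin.≟ suc i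

  degree? : ∀ h u i → Decidable (λ e → ColorClass i h e × u Subset.∈ edge e)
  degree? h u i e = colorClass? i h e ×-dec (u ∈? edge e)

  degree : Coloring c m → Fin n → ColoredDegree c
  degree h u = tabulate λ i → # degree? h u i

  -- A vertex of degree `𝟘` meets no colored edge and so is not a vertex of the edge-induced
  -- subgraph; it must not be counted.
  hasDegree? : ∀ h δ → Decidable (λ u → degree h u ≡ δ × δ ≢ 𝟘)
  hasDegree? h δ u = (degree h u ≟ᵈ δ) ×-dec ¬? (δ ≟ᵈ 𝟘)

  census : Coloring c m → ColoredDegree c → ℕ
  census h δ = # hasDegree? h δ

  Accept : Pred (Coloring c m) 0ℓ
  Accept h = Extends s t (census h) × (∀ i → Connected (ColorClass i h))

  -- Only finitely many degrees need a test: the lower bound is trivial outside `s`, and the upper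
  -- bound is trivial for degrees that no vertex has.
  extends? : ∀ h → Dec (Extends s t (census h))
  extends? h = map′ sound (λ ext → All.tabulate (λ {δ} _ → proj₁ (ext δ)) , λ u → proj₂ (ext (degree h u)))
    (All.all? (λ δ → multiplicity s δ ℕ.≤? census h δ) s ×-dec
     Fin.all? λ u → (degree h u ∈ᵈ? t) ⊎-dec (census h (degree h u) ℕ.≤? multiplicity s (degree h u)))
    where
    sound : All (λ δ → multiplicity s δ ≤ census h δ) s ×
            (∀ u → degree h u ∈ t ⊎ census h (degree h u) ≤ multiplicity s (degree h u)) → Extends s t (census h)
    sound (lower , upper) δ = lower′ , upper′
      where
      lower′ : multiplicity s δ ≤ census h δ
      lower′ with δ ∈ᵈ? s
      ... | yes δ∈s = All.lookup lower δ∈s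
      ... | no  δ∉s = ℕ.≤-trans (ℕ.≤-reflexive (multiplicity-∉ δ∉s)) z≤n
      upper′ : δ ∈ t ⊎ census h δ ≤ multiplicity s δ
      upper′ with census h δ ℕ.≤? multiplicity s δ
      ... | yes ≤s = inj₂ ≤s
      ... | no  ≰s with _ , refl , _ ← to (#>0 (hasDegree? h δ)) (ℕ.≤-<-trans z≤n (ℕ.≰⇒> ≰s)) = upper _

  accept? : Decidable Accept
  accept? h = extends? h ×-dec Fin.all? λ i → connected? (colorClass? i h)

  degree≢𝟘 : ∀ h u → degree h u ≢ 𝟘 ⇔ (∃[ i ] Touched (ColorClass i h) u)
  degree≢𝟘 h u = mk⇔ to′ from′
    where
    lookup-degree : ∀ i → Vec.lookup (degree h u) i ≡ # degree? h u i
    lookup-degree = Vec.lookup∘tabulate _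
    to′ : degree h u ≢ 𝟘 → ∃[ i ] Touched (ColorClass i h) u
    to′ ≢𝟘 with Fin.any? (λ i → touched? (colorClass? i h) u)
    ... | yes p = p
    ... | no ∄  = contradiction (trans (Vec.tabulate-cong zeros) (Vec.tabulate∘lookup 𝟘)) ≢𝟘
      where
      zeros : ∀ i → # degree? h u i ≡ Vec.lookup 𝟘 i
      zeros i = trans (ℕ.n≤0⇒n≡0 (ℕ.≮⇒≥ λ 0<# → ∄ (i , to (#>0 (degree? h u i)) 0<#)))
                      (sym (Vec.lookup-replicate i 0))
    from′ : ∃[ i ] Touched (ColorClass i h) u → degree h u ≢ 𝟘
    from′ (i , ti) ≡𝟘 = ℕ.>⇒≢ (from (#>0 (degree? h u i)) ti)
      (trans (sym (lookup-degree i)) (trans (cong (λ δ → Vec.lookup δ i) ≡𝟘) (Vec.lookup-replicate i 0)))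

  module _ {h : Coloring c m} {B : ColoredSubset c m} (colors : Colors h B) where

    private
      F = edgeInduced G B

    coloredDegree≡degree : ∀ u → coloredDegree F u ≡ degree h u
    coloredDegree≡degree u = Vec.tabulate-cong λ i → ℕ.≤-antisym
      (p⊆q⇒∣p∣≤∣q∣ λ {e} e∈ → let e∈B , e∈u = x∈p∩q⁻ (part B i) _ e∈ in
         from (∈-comprehension (degree? h u i))
           (to (colors i e) e∈B , to (∈-comprehension (λ e → u ∈? edge e)) e∈u))
      (p⊆q⇒∣p∣≤∣q∣ λ {e} e∈ → let he , u∈e = to (∈-comprehension (degree? h u i)) e∈ in
         x∈p∩q⁺ (from (colors i e) he , from (∈-comprehension (λ e → u ∈? edge e)) u∈e))

    vertex⇔degree≢𝟘 : ∀ u → u Subset.∈ ColoredGraph.vertices F ⇔ degree h u ≢ 𝟘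
    vertex⇔degree≢𝟘 u = ⇔.trans (∈-comprehension (endpoint? G B)) (⇔.trans
      (mk⇔ (λ (i , e , e∈B , u∈e) → i , e , to (colors i e) e∈B , u∈e)
           (λ (i , e , he , u∈e) → i , e , from (colors i e) he , u∈e))
      (⇔.sym (degree≢𝟘 h u)))

    multiplicity-DS : ∀ δ → multiplicity (DS F) δ ≡ census h δ
    multiplicity-DS δ =
      trans (length-filter-map-filter (δ ≟ᵈ_) (_∈? ColoredGraph.vertices F) (coloredDegree F) (allFin n))
      (trans (length-filter-tabulate (λ u → (δ ≟ᵈ coloredDegree F u) ×-dec (u ∈? ColoredGraph.vertices F)) id)
      (#-cong _ (hasDegree? h δ) λ u → mk⇔
        (λ (δ≡ , u∈) → sym (trans δ≡ (coloredDegree≡degree u)) ,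
           subst (_≢ 𝟘) (sym (trans δ≡ (coloredDegree≡degree u))) (to (vertex⇔degree≢𝟘 u) u∈))
        (λ (≡δ , δ≢𝟘) → trans (sym ≡δ) (sym (coloredDegree≡degree u)) ,
           from (vertex⇔degree≢𝟘 u) (subst (_≢ 𝟘) (sym ≡δ) δ≢𝟘))))

    extends-cong : ∀ {N N′} → (∀ δ → N δ ≡ N′ δ) → Extends s t N → Extends s t N′
    extends-cong eq ext δ =
      subst (λ k → multiplicity s δ ≤ k × (δ ∈ t ⊎ k ≤ multiplicity s δ)) (eq δ) (ext δ)

    connected⇔ : ∀ i → ColorConnected F i ⇔ Connected (ColorClass i h)
    connected⇔ i = mk⇔
      (λ conn u v tu tv → Star.map (λ (e , e∈B , _ , uv) → e , to (colors i e) e∈B , uv)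
                            (conn u v (untouch tu) (untouch tv)))
      (λ conn u v (e , e∈B , u∈e) (e′ , e′∈B , v∈e′) →
         toColored (conn u v (e , to (colors i e) e∈B , u∈e) (e′ , to (colors i e′) e′∈B , v∈e′)))
      where
      untouch : ∀ {u} → Touched (ColorClass i h) u → ColorVertex F i u
      untouch (e , he , u∈e) = e , from (colors i e) he , u∈e
      toColored : ∀ {u v} → Reach (ColorClass i h) u v → Star (ColorAdjacent F i) u v
      toColored ε = ε
      toColored {u} ((_◅_ {j = w}) (e , he , u∈e , w∈e) path) with u Fin.≟ w
      -- `Adjacent` admits steps from a vertex to itself and `ColorAdjacent` does not, so these are
      -- dropped.
      ... | yes refl = toColored path
      ... | no  u≢w  = (e , from (colors i e) he , u≢w , u∈e , w∈e) ◅ toColored path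

    satisfies⇔accept : Satisfies F s t ⇔ Accept h
    satisfies⇔accept = mk⇔
      (λ sat → let r , r⊆t , DS↭ = Satisfies.degrees sat in
         extends-cong multiplicity-DS (split⇒extends {xs = DS F} r⊆t DS↭) ,
         λ i → to (connected⇔ i) (Satisfies.connected sat i))
      (λ (ext , conn) → record
         { degrees   = extends⇒split s {xs = DS F} (extends-cong (sym ∘ multiplicity-DS) ext)
         ; connected = λ i → from (connected⇔ i) (conn i) })

-- The frontier data of a prefix and their number

module Prefixes (G : Graph) {c : ℕ} (s t : List (ColoredDegree c)) (ℓ : Fin (Graph.m G)) where
  open Graph G
  open Connectivity G
  open Subgraphs G s t
  open Diagram Accept accept? using (Live; Residual≈; size; size-bound)

  k : ℕ
  k = toℕ ℓ

  Past : Fin c → Coloring c m → Pred (Fin m) 0ℓ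
  Past i f e = ColorClass i f e × toℕ e < k

  Future : Fin c → Coloring c m → Pred (Fin m) 0ℓ
  Future i g e = ColorClass i g e × ¬ (toℕ e < k)

  past? : ∀ i f → Decidable (Past i f)
  past? i f e = colorClass? i f e ×-dec (toℕ e ℕ.<? k)

  mix-past : ∀ {i} f g {e} → toℕ e < k → ColorClass i (mix k f g) e ⇔ ColorClass i f e
  mix-past f g e<k rewrite lookup-mix-< f g e<k = ⇔.refl

  mix-future : ∀ {i} f g {e} → ¬ (toℕ e < k) → ColorClass i (mix k f g) e ⇔ ColorClass i g e
  mix-future f g e≮k rewrite lookup-mix-≥ f g (ℕ.≮⇒≥ e≮k) = ⇔.refl

  colorClass-mix : ∀ i f g e → ColorClass i (mix k f g) e ⇔ (Past i f ∪ₚ Future i g) e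
  colorClass-mix i f g e with toℕ e ℕ.<? k
  ... | yes e<k = ⇔.trans (mix-past f g e<k)
    (mk⇔ (λ fe → inj₁ (fe , e<k)) λ { (inj₁ (fe , _)) → fe ; (inj₂ (_ , e≮k)) → contradiction e<k e≮k })
  ... | no e≮k = ⇔.trans (mix-future f g e≮k)
    (mk⇔ (λ ge → inj₂ (ge , e≮k)) λ { (inj₂ (ge , _)) → ge ; (inj₁ (_ , e<k)) → contradiction e<k e≮k })

  pastDegree? : ∀ f u i → Decidable (λ e → (ColorClass i f e × u Subset.∈ edge e) × toℕ e < k)
  pastDegree? f u i e = degree? f u i e ×-dec (toℕ e ℕ.<? k)

  futureDegree? : ∀ g u i → Decidable (λ e → (ColorClass i g e × u Subset.∈ edge e) × ¬ (toℕ e < k))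
  futureDegree? g u i e = degree? g u i e ×-dec ¬? (toℕ e ℕ.<? k)

  pastDegree : Coloring c m → Fin n → ColoredDegree c
  pastDegree f u = tabulate λ i → # pastDegree? f u i

  futureDegree : Coloring c m → Fin n → ColoredDegree c
  futureDegree g u = tabulate λ i → # futureDegree? g u i

  #degree-mix : ∀ f g u i → # degree? (mix k f g) u i ≡ # pastDegree? f u i + # futureDegree? g u i
  #degree-mix f g u i = trans (#-split (degree? (mix k f g) u i) (λ e → toℕ e ℕ.<? k)) (cong₂ _+_
    (#-cong _ (pastDegree? f u i) λ e → mk⇔
      (λ ((he , u∈e) , e<k) → (to (mix-past f g e<k) he , u∈e) , e<k)
      (λ ((fe , u∈e) , e<k) → (from (mix-past f g e<k) fe , u∈e) , e<k))
    (#-cong _ (futureDegree? g u i) λ e → mk⇔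
      (λ ((he , u∈e) , e≮k) → (to (mix-future f g e≮k) he , u∈e) , e≮k)
      (λ ((ge , u∈e) , e≮k) → (from (mix-future f g e≮k) ge , u∈e) , e≮k)))

  degree-mix : ∀ f g u → degree (mix k f g) u ≡ zipWith _+_ (pastDegree f u) (futureDegree g u)
  degree-mix f g u = lookup-ext λ i → begin
    Vec.lookup (degree (mix k f g) u) i
      ≡⟨ Vec.lookup∘tabulate _ i ⟩
    # degree? (mix k f g) u i
      ≡⟨ #degree-mix f g u i ⟩
    # pastDegree? f u i + # futureDegree? g u i
      ≡⟨ cong₂ _+_ (Vec.lookup∘tabulate _ i) (Vec.lookup∘tabulate _ i) ⟨
    Vec.lookup (pastDegree f u) i + Vec.lookup (futureDegree g u) i
      ≡⟨ Vec.lookup-zipWith _+_ i (pastDegree f u) (futureDegree g u) ⟨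
    Vec.lookup (zipWith _+_ (pastDegree f u) (futureDegree g u)) i ∎
    where open ≡-Reasoning

  pastDegree-≼ : ∀ f g u → pastDegree f u ≼ degree (mix k f g) u
  pastDegree-≼ f g u = Pointwise.tabulate⁺ λ i →
    ℕ.≤-trans (ℕ.m≤m+n _ _) (ℕ.≤-reflexive (sym (#degree-mix f g u i)))

  -- Such a vertex meets no remaining edge, since it would otherwise belong to the frontier; its
  -- degree is final by `degree-closed`.
  Closed : Pred (Fin n) 0ℓ
  Closed u = (∃[ e ] (toℕ e < k × u Subset.∈ edge e)) × ¬ InFrontier G ℓ u

  closed? : Decidable Closed
  closed? u = Fin.any? (λ e → (toℕ e ℕ.<? k) ×-dec (u ∈? edge e)) ×-dec ¬? (inFrontier? G ℓ u)

  degree-closed : ∀ f g {u} → Closed u → degree (mix k f g) u ≡ pastDegree f u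
  degree-closed f g {u} (past , ∉F) = Vec.tabulate-cong λ i → trans (#degree-mix f g u i) (trans
    (cong (# pastDegree? f u i +_) (ℕ.n≤0⇒n≡0 (ℕ.≮⇒≥ λ 0<# →
      let e , (_ , u∈e) , e≮k = to (#>0 (futureDegree? g u i)) 0<# in ∉F (past , e , ℕ.≮⇒≥ e≮k , u∈e))))
    (ℕ.+-identityʳ _))

  -- A vertex that is not closed lies in the frontier, where the hypothesis applies, or meets no
  -- earlier edge, and then both past degrees are zero.
  pastDegree-cong : ∀ f f′ {u} → (InFrontier G ℓ u → pastDegree f u ≡ pastDegree f′ u) → ¬ Closed u →
                    pastDegree f u ≡ pastDegree f′ u
  pastDegree-cong f f′ {u} eq open′ with Fin.any? (λ e → (toℕ e ℕ.<? k) ×-dec (u ∈? edge e)) | inFrontier? G ℓ u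
  ... | _        | yes u∈F = eq u∈F
  ... | yes past | no  u∉F = contradiction (past , u∉F) open′
  ... | no  ∄    | no  _   = Vec.tabulate-cong λ i → #-cong (pastDegree? f u i) (pastDegree? f′ u i) λ e → mk⇔
    (λ ((_ , u∈e) , e<k) → contradiction (e , e<k , u∈e) ∄)
    (λ ((_ , u∈e) , e<k) → contradiction (e , e<k , u∈e) ∄)

  closedCensus? : ∀ f δ → Decidable (λ u → (pastDegree f u ≡ δ × δ ≢ 𝟘) × Closed u)
  closedCensus? f δ u = ((pastDegree f u ≟ᵈ δ) ×-dec ¬? (δ ≟ᵈ 𝟘)) ×-dec closed? u

  closedCensus : Coloring c m → ColoredDegree c → ℕ
  closedCensus f δ = # closedCensus? f δ

  openCensus? : ∀ h δ → Decidable (λ u → (degree h u ≡ δ × δ ≢ 𝟘) × ¬ Closed u)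
  openCensus? h δ u = hasDegree? h δ u ×-dec ¬? (closed? u)

  census-mix : ∀ f g δ → census (mix k f g) δ ≡ closedCensus f δ + # openCensus? (mix k f g) δ
  census-mix f g δ = trans (#-split (hasDegree? (mix k f g) δ) closed?) (cong (_+ # openCensus? (mix k f g) δ)
    (#-cong _ (closedCensus? f δ) λ u → mk⇔
      (λ ((≡δ , δ≢𝟘) , cl) → (trans (sym (degree-closed f g cl)) ≡δ , δ≢𝟘) , cl)
      (λ ((≡δ , δ≢𝟘) , cl) → (trans (degree-closed f g cl) ≡δ , δ≢𝟘) , cl)))

  record Indistinguishable (f f′ : Coloring c m) : Set where
    field
      degrees : ∀ {u} → InFrontier G ℓ u → pastDegree f u ≡ pastDegree f′ u
      reach   : ∀ i {u v} → InFrontier G ℓ u → InFrontier G ℓ v →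
                Reach (Past i f) u v ⇔ Reach (Past i f′) u v
      closed  : ∀ i → HasClosedComponent (Past i f) (InFrontier G ℓ) ⇔
                      HasClosedComponent (Past i f′) (InFrontier G ℓ)
      counts  : ∀ δ → closedCensus f δ ⊓ multiplicity s δ ≡ closedCensus f′ δ ⊓ multiplicity s δ

  indistinguishable-sym : ∀ {f f′} → Indistinguishable f f′ → Indistinguishable f′ f
  indistinguishable-sym I = record
    { degrees = λ u∈F → sym (degrees u∈F)
    ; reach   = λ i u∈F v∈F → ⇔.sym (reach i u∈F v∈F)
    ; closed  = λ i → ⇔.sym (closed i)
    ; counts  = λ δ → sym (counts δ)
    }
    where open Indistinguishable I

  openCensus-cong : ∀ {f f′} → Indistinguishable f f′ → ∀ g δ →
                    # openCensus? (mix k f g) δ ≡ # openCensus? (mix k f′ g) δ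
  openCensus-cong {f} {f′} I g δ = #-cong (openCensus? (mix k f g) δ) (openCensus? (mix k f′ g) δ) λ u → mk⇔
    (λ ((≡δ , δ≢𝟘) , op) → (trans (sym (eq op)) ≡δ , δ≢𝟘) , op)
    (λ ((≡δ , δ≢𝟘) , op) → (trans (eq op) ≡δ , δ≢𝟘) , op)
    where
    eq : ∀ {u} → ¬ Closed u → degree (mix k f g) u ≡ degree (mix k f′ g) u
    eq {u} op = trans (degree-mix f g u) (trans
      (cong (λ δ → zipWith _+_ δ (futureDegree g u)) (pastDegree-cong f f′ (Indistinguishable.degrees I) op))
      (sym (degree-mix f′ g u)))

  -- Through this the recorded degrees also tell which frontier vertices a color has met, as
  -- `exchange` requires.
  touched-past : ∀ i f u → Touched (Past i f) u ⇔ 0 < Vec.lookup (pastDegree f u) i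
  touched-past i f u = ⇔.trans
    (mk⇔ (λ (e , (fe , e<k) , u∈e) → e , (fe , u∈e) , e<k) (λ (e , (fe , u∈e) , e<k) → e , (fe , e<k) , u∈e))
    (subst (λ d → ∃ (λ e → (ColorClass i f e × u Subset.∈ edge e) × toℕ e < k) ⇔ 0 < d)
      (sym (Vec.lookup∘tabulate (λ i → # pastDegree? f u i) i)) (⇔.sym (#>0 (pastDegree? f u i))))

  separates : ∀ i f g → Separates (InFrontier G ℓ) (Past i f) (Future i g)
  separates i f g (e , (_ , e<k) , u∈e) (e′ , (_ , e′≮k) , u∈e′) = (e , e<k , u∈e) , (e′ , ℕ.≮⇒≥ e′≮k , u∈e′)

  -- The completion `g′` that keeps `f′` alive is used for both conditions: it bounds the closed
  -- counts of `f′` in `capped-exchange`, and in `exchange` it shows that a closed component of `f′`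
  -- is the only component of its color.
  accept-transfer : ∀ {f f′} → Indistinguishable f f′ → Live k f′ →
                    ∀ g → Accept (mix k f g) → Accept (mix k f′ g)
  accept-transfer {f} {f′} I (g′ , ext′ , conn′) g (ext , conn) = ext″ , conn″
    where
    open Indistinguishable I
    ext″ : Extends s t (census (mix k f′ g))
    ext″ δ with ext δ | ext′ δ
    ... | lower , upper | _ , upper′
      rewrite census-mix f g δ | census-mix f′ g′ δ | census-mix f′ g δ | openCensus-cong I g δ =
      capped-exchange (counts δ) lower upper upper′

    conn″ : ∀ i → Connected (ColorClass i (mix k f′ g))
    conn″ i = connected-cong (⇔.sym ∘ colorClass-mix i f′ g)
      (exchange (inFrontier? G ℓ) (past? i f′) edge-nonempty (separates i f g) (separates i f′ g′)
        (λ {u} u∈F → ⇔.trans (touched-past i f u) (⇔.trans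
          (subst (λ δ → 0 < Vec.lookup (pastDegree f u) i ⇔ 0 < Vec.lookup δ i) (degrees u∈F) ⇔.refl)
          (⇔.sym (touched-past i f′ u))))
        (λ u∈F v∈F → to (reach i u∈F v∈F))
        (closed i)
        (connected-cong (colorClass-mix i f g) (conn i))
        (connected-cong (colorClass-mix i f′ g′) (conn′ i)))

  F : Subset n
  F = frontier G ℓ

  reachability : Fin c → Coloring c m → DecSetoid 0ℓ 0ℓ
  reachability i f = record
    { Carrier = Fin ∣ F ∣
    ; _≈_     = λ a b → Reach (Past i f) (enumerate F a) (enumerate F b)
    ; isDecEquivalence = record
      { isEquivalence = record { refl = ε ; sym = reach-sym ; trans = _◅◅_ }
      ; _≟_ = λ a b → reach? (past? i f) (enumerate F a) (enumerate F b)
      }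
    }

  module Components i f = Quotient (reachability i f) (allFin ∣ F ∣) ∈-allFin

  -- A completion only raises degrees, so the final degree dominates. If that is nonzero, it lies in
  -- `t`, or its positive count is at most its multiplicity in `s`, which puts it in `s`. If it is
  -- zero, it is dominated by `x`; this is where `s` and `t` must not both be empty.
  ∈-𝒟-pastDegree : ∀ {x} → x ∈ s ++ t → ∀ f → Live k f → ∀ u → pastDegree f u ∈ 𝒟 (s ++ t)
  ∈-𝒟-pastDegree {x} x∈ f (g , ext , _) u = from (∈-𝒟 (s ++ t)) (dominating (degree (mix k f g) u) refl)
    where
    dominating : ∀ δ → degree (mix k f g) u ≡ δ → ∃[ δ ] (δ ∈ s ++ t × pastDegree f u ≼ δ)
    past≼ : ∀ {δ} → degree (mix k f g) u ≡ δ → pastDegree f u ≼ δ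
    past≼ refl = pastDegree-≼ f g u
    dominating δ eq with δ ≟ᵈ 𝟘
    ... | yes refl = x , x∈ , Pointwise.trans ℕ.≤-trans (past≼ eq) (𝟘-≼ x)
    ... | no δ≢𝟘 with proj₂ (ext δ)
    ...   | inj₁ δ∈t = δ , ∈-++⁺ʳ s δ∈t , past≼ eq
    ...   | inj₂ ≤s  = δ , ∈-++⁺ˡ {xs = s} (multiplicity>0 {s = s}
                         (ℕ.<-≤-trans (from (#>0 (hasDegree? (mix k f g) δ)) (u , eq , δ≢𝟘)) ≤s)) , past≼ eq

  -- For each color, the 2 stands for the presence of a closed component, and `∣ F ∣ ^ ∣ F ∣` counts
  -- the maps from the frontier to itself, a crude bound for its partitions: each partition is given
  -- by the map to class representatives.
  keyCount : ℕ
  keyCount = (length (𝒟 (s ++ t)) ^ ∣ F ∣ * (2 * ∣ F ∣ ^ ∣ F ∣) ^ c) * ∏[multiplicity+1] s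

  module _ {x} (x∈ : x ∈ s ++ t) where

    degreeCode : ∀ f → Live k f → Fin ∣ F ∣ → Fin (length (𝒟 (s ++ t)))
    degreeCode f l a = Any.index (∈-𝒟-pastDegree x∈ f l (enumerate F a))

    closedCode : Coloring c m → Fin c → Fin 2
    closedCode f i = decToFin (hasClosedComponent? (past? i f) (inFrontier? G ℓ))

    colorCode : Coloring c m → Fin c → Fin (2 * ∣ F ∣ ^ ∣ F ∣)
    colorCode f i = combine (closedCode f i) (funToFin (Components.canonical i f))

    countCode : Coloring c m → ∀ δ → Fin (suc (multiplicity s δ))
    countCode f δ = fromℕ< (s≤s (ℕ.m⊓n≤n (closedCensus f δ) (multiplicity s δ)))

    frontierCode : ∀ f → Live k f → Fin (length (𝒟 (s ++ t)) ^ ∣ F ∣ * (2 * ∣ F ∣ ^ ∣ F ∣) ^ c)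
    frontierCode f l = combine (funToFin (degreeCode f l)) (funToFin (colorCode f))

    countsCode : Coloring c m → Fin (∏[multiplicity+1] s)
    countsCode f = tupleToFin (countCode f) (deduplicate _≟ᵈ_ s)

    key : ∀ f → Live k f → Fin keyCount
    key f l = combine (frontierCode f l) (countsCode f)

    key-indistinguishable : ∀ f f′ l l′ → key f l ≡ key f′ l′ → Indistinguishable f f′
    key-indistinguishable f f′ l l′ eq = record
      { degrees = λ u∈F → let a , a↦u = inF u∈F in
          subst (λ u → pastDegree f u ≡ pastDegree f′ u) a↦u (degrees′ a)
      ; reach   = λ i u∈F v∈F → let a , a↦u = inF u∈F ; b , b↦v = inF v∈F in
          subst₂ (λ u v → Reach (Past i f) u v ⇔ Reach (Past i f′) u v) a↦u b↦v (reach′ i a b)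
      ; closed  = λ i → decToFin-injective (hasClosedComponent? (past? i f) (inFrontier? G ℓ))
                          (hasClosedComponent? (past? i f′) (inFrontier? G ℓ)) (proj₁ (colors′ i))
      ; counts  = counts′
      }
      where
      eqs  = Fin.combine-injective (frontierCode f l) (countsCode f) (frontierCode f′ l′) (countsCode f′) eq
      eqs₁ = Fin.combine-injective (funToFin (degreeCode f l)) (funToFin (colorCode f))
                                   (funToFin (degreeCode f′ l′)) (funToFin (colorCode f′)) (proj₁ eqs)

      inF : ∀ {u} → InFrontier G ℓ u → ∃[ a ] enumerate F a ≡ u
      inF u∈F = enumerate-surjective (from (∈-comprehension (inFrontier? G ℓ)) u∈F)

      degrees′ : ∀ a → pastDegree f (enumerate F a) ≡ pastDegree f′ (enumerate F a)
      degrees′ a = trans (lookup-index (∈-𝒟-pastDegree x∈ f l (enumerate F a)))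
        (trans (cong (lookup (𝒟 (s ++ t))) (funToFin-injective (proj₁ eqs₁) a))
          (sym (lookup-index (∈-𝒟-pastDegree x∈ f′ l′ (enumerate F a)))))

      colors′ : ∀ i → closedCode f i ≡ closedCode f′ i
                    × funToFin (Components.canonical i f) ≡ funToFin (Components.canonical i f′)
      colors′ i = Fin.combine-injective _ _ _ _ (funToFin-injective (proj₂ eqs₁) i)

      reach′ : ∀ i a b → Reach (Past i f) (enumerate F a) (enumerate F b) ⇔ Reach (Past i f′) (enumerate F a) (enumerate F b)
      reach′ i a b = ⇔.trans (⇔.sym (Components.canonical-≡⇔ i f)) (⇔.trans
        (mk⇔ (λ e → trans (sym (same a)) (trans e (same b))) (λ e → trans (same a) (trans e (sym (same b)))))
        (Components.canonical-≡⇔ i f′))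
        where
        same : ∀ a → Components.canonical i f a ≡ Components.canonical i f′ a
        same = funToFin-injective (proj₂ (colors′ i))

      counts′ : ∀ δ → closedCensus f δ ⊓ multiplicity s δ ≡ closedCensus f′ δ ⊓ multiplicity s δ
      counts′ δ with δ ∈ᵈ? s
      -- Outside `s` the cap is 0, so both sides vanish although the key records nothing there.
      ... | no  δ∉s rewrite multiplicity-∉ δ∉s =
        trans (ℕ.⊓-zeroʳ (closedCensus f δ)) (sym (ℕ.⊓-zeroʳ (closedCensus f′ δ)))
      ... | yes δ∈s = Fin.fromℕ<-injective _ _ _ _
        (tupleToFin-injective {f = countCode f} {g = countCode f′} (deduplicate _≟ᵈ_ s)
          (proj₂ eqs) (∈-deduplicate⁺ _≟ᵈ_ δ∈s))

    size≤keyCount : size ℓ ≤ suc keyCount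
    size≤keyCount = size-bound ℓ key λ f f′ l l′ eq g →
      let I = key-indistinguishable f f′ l l′ eq in
      mk⇔ (accept-transfer I l′ g) (accept-transfer (indistinguishable-sym I) l g)

-- Arithmetic of the width bound

n<2^[1+⌊log₂n⌋] : ∀ n → n < 2 ^ suc ⌊log₂ n ⌋
n<2^[1+⌊log₂n⌋] n = ℕ.≰⇒> λ 2^≤n → ℕ.1+n≰n
  (ℕ.≤-trans (ℕ.≤-reflexive (sym (⌊log₂[2^n]⌋≡n (suc ⌊log₂ n ⌋)))) (⌊log₂⌋-mono-≤ 2^≤n))

-- With `L = ⌊log₂ n ⌋`, rounding the logarithm up gives the exponent `1 + suc L * n`. Since `n ≥ 2`
-- makes `L` positive, the 1 costs at most one multiple of `n * L` and `suc L * n` at most two;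
-- hence the 3.
n^n-bound : ∀ {k n} → k ≤ n → 2 ≤ n → 2 * k ^ k ≤ 2 ^ (3 * (n * ⌊log₂ n ⌋))
n^n-bound {k} {n} k≤n 2≤n = begin
  2 * k ^ k                       ≤⟨ ℕ.*-monoʳ-≤ 2 (ℕ.^-monoˡ-≤ k k≤n) ⟩
  2 * n ^ k                       ≤⟨ ℕ.*-monoʳ-≤ 2 (ℕ.^-monoʳ-≤ n {{>-nonZero (ℕ.≤-trans (s≤s z≤n) 2≤n)}} k≤n) ⟩
  2 * n ^ n                       ≤⟨ ℕ.*-monoʳ-≤ 2 (ℕ.^-monoˡ-≤ n (ℕ.<⇒≤ (n<2^[1+⌊log₂n⌋] n))) ⟩
  2 * (2 ^ suc L) ^ n             ≡⟨ cong (2 *_) (ℕ.^-*-assoc 2 (suc L) n) ⟩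
  2 ^ (1 + suc L * n)             ≤⟨ ℕ.^-monoʳ-≤ 2 (ℕ.+-mono-≤ 1≤nL [1+L]n≤2nL) ⟩
  2 ^ (n * L + 2 * (n * L))       ∎
  where
  open ℕ.≤-Reasoning
  L = ⌊log₂ n ⌋
  1≤L : 1 ≤ L
  1≤L = ⌊log₂⌋-mono-≤ 2≤n
  1≤nL : 1 ≤ n * L
  1≤nL = ℕ.*-mono-≤ (ℕ.<⇒≤ 2≤n) 1≤L
  1+L≤2L : suc L ≤ 2 * L
  1+L≤2L = ℕ.+-mono-≤ 1≤L (ℕ.≤-reflexive (sym (ℕ.+-identityʳ L)))
  [1+L]n≤2nL : suc L * n ≤ 2 * (n * L)
  [1+L]n≤2nL = ℕ.≤-trans (ℕ.*-monoˡ-≤ n 1+L≤2L)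
    (ℕ.≤-reflexive (trans (ℕ.*-assoc 2 L n) (cong (2 *_) (ℕ.*-comm L n))))

product-suc>0 : ∀ {A : Set} (f : A → ℕ) xs → 0 < product (map (suc ∘ f) xs)
product-suc>0 f []       = s≤s z≤n
product-suc>0 f (x ∷ xs) = ℕ.*-mono-≤ {1} {suc (f x)} (s≤s z≤n) (product-suc>0 f xs)

-- The exponent grows from 3 to 4 to absorb the node for dead prefixes: the product is positive, so
-- adding 1 at most doubles it, and `c * X ≥ 1` pays for the doubling. Replacing `w` by `w ⊔ 2`
-- keeps the logarithm positive for frontiers of size 0 and 1.
keyCount-bound : ∀ {c D w k P} .{{_ : NonZero c}} → k ≤ w → 0 < D → 0 < P → let w′ = w ⊔ 2 in
  suc ((D ^ k * (2 * k ^ k) ^ c) * P) ≤ 2 ^ (4 * (c * (w′ * ⌊log₂ w′ ⌋))) * D ^ w * P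
keyCount-bound {c} {D} {w} {k} {P} k≤w 0<D 0<P = begin
  suc (D ^ k * (2 * k ^ k) ^ c * P)
    ≤⟨ s≤s (ℕ.*-monoˡ-≤ P (ℕ.*-mono-≤ (ℕ.^-monoʳ-≤ D k≤w) (ℕ.^-monoˡ-≤ c partitions))) ⟩
  suc (D ^ w * (2 ^ (3 * X)) ^ c * P)
    ≡⟨ cong (λ x → suc (x * P)) (trans (ℕ.*-comm (D ^ w) _) (cong (_* D ^ w) powers)) ⟩
  1 + Y * D ^ w * P
    ≤⟨ ℕ.+-monoˡ-≤ _ (ℕ.*-mono-≤ (ℕ.*-mono-≤ (ℕ.m^n>0 2 (3 * (c * X))) (ℕ.m^n>0 D w)) 0<P) ⟩
  Y * D ^ w * P + Y * D ^ w * P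
    ≡⟨ ℕ.*-distribʳ-+ P (Y * D ^ w) (Y * D ^ w) ⟨
  (Y * D ^ w + Y * D ^ w) * P
    ≡⟨ cong (_* P) (ℕ.*-distribʳ-+ (D ^ w) Y Y) ⟨
  (Y + Y) * D ^ w * P
    ≤⟨ ℕ.*-monoˡ-≤ P (ℕ.*-monoˡ-≤ (D ^ w) doubled) ⟩
  2 ^ (4 * (c * X)) * D ^ w * P ∎
  where
  open ℕ.≤-Reasoning
  w′ = w ⊔ 2
  X  = w′ * ⌊log₂ w′ ⌋
  Y  = 2 ^ (3 * (c * X))
  instance
    D≢0 = >-nonZero 0<D
  partitions : 2 * k ^ k ≤ 2 ^ (3 * X)
  partitions = n^n-bound (ℕ.≤-trans k≤w (ℕ.m≤m⊔n w 2)) (ℕ.m≤n⊔m w 2)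
  powers : (2 ^ (3 * X)) ^ c ≡ Y
  powers = trans (ℕ.^-*-assoc 2 (3 * X) c)
    (cong (2 ^_) (trans (ℕ.*-assoc 3 X c) (cong (3 *_) (ℕ.*-comm X c))))
  1≤cX : 1 ≤ c * X
  1≤cX = ℕ.*-mono-≤ {1} {c} (>-nonZero⁻¹ c)
    (ℕ.*-mono-≤ {1} {w′} (ℕ.≤-trans (s≤s z≤n) (ℕ.m≤n⊔m w 2)) (⌊log₂⌋-mono-≤ (ℕ.m≤n⊔m w 2)))
  doubled : Y + Y ≤ 2 ^ (4 * (c * X))
  doubled = ℕ.≤-trans (ℕ.≤-reflexive (cong (Y +_) (sym (ℕ.+-identityʳ Y))))
    (ℕ.^-monoʳ-≤ 2 {1 + 3 * (c * X)} {c * X + 3 * (c * X)} (ℕ.+-monoˡ-≤ (3 * (c * X)) 1≤cX))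

-- From single levels to the width, and the case of empty `s` and `t`

width-bound : ∀ {c m N} (Z : DD c m) → (∀ ℓ → DD.size Z ℓ ≤ N) → DD.width Z ≤ N
width-bound Z size≤ = f[argmax]≤v⁺ {f = id} z≤n (All.tabulate⁺ size≤)

frontier≤maxFrontierSize : ∀ G ℓ → ∣ frontier G ℓ ∣ ≤ maxFrontierSize G
frontier≤maxFrontierSize G ℓ = All.tabulate⁻ (xs≤max 0 (List.tabulate λ i → ∣ frontier G i ∣)) ℓ

-- The bound vanishes if s and t are empty and some frontier is not, so that
-- the diagram of the empty subgraph must not have any non-terminal node.
emptyDiagram : ∀ {c m} → DD c m
emptyDiagram = record
  { size = λ _ → 0 ; root = ⊤-node ; arc = λ _ () ; arc-label = λ {_} {} ; root-unique = λ _ () }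

-- A colored edge has an endpoint, whose degree would be an element of the empty multiset; so only
-- the empty subgraph qualifies.
emptyDiagram-represents : ∀ {c} (G : Graph) →
                          DD.Represents {c} emptyDiagram (𝒢 G (λ F → Satisfies F [] []))
emptyDiagram-represents {c} G B = mk⇔ to′ from′
  where
  open Graph G
  F = edgeInduced G B

  to′ : ∃[ p ] DD.PathRepresents emptyDiagram p B → Satisfies F [] []
  to′ (DD.done , rep) = record
    { degrees   = [] , [] , ↭-reflexive (cong (map (coloredDegree F))
                    (filter-none (_∈? ColoredGraph.vertices F) (All.universal no-vertex (allFin n))))
    ; connected = λ i u v (e , e∈B , _) → contradiction e∈B (absent i e)
    }
    where
    absent : ∀ i e → ¬ (e Subset.∈ part B i)
    absent i e e∈B with () ← to (rep i e) e∈B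
    no-vertex : ∀ u → ¬ (u Subset.∈ ColoredGraph.vertices F)
    no-vertex u u∈ = let i , e , e∈B , _ = to (∈-comprehension (endpoint? G B)) u∈ in absent i e e∈B

  from′ : Satisfies F [] [] → ∃[ p ] DD.PathRepresents emptyDiagram p B
  from′ sat with Satisfies.degrees sat
  ... | _ ∷ _ , () ∷ _ , _
  ... | [] , _ , DS↭[] = DD.done , λ j e → mk⇔ (λ e∈B → contradiction e∈B (absent j e)) λ ()
    where
    absent : ∀ i e → ¬ (e Subset.∈ part B i)
    absent i e e∈B
      with u , u∈e ← Subgraphs.edge-nonempty G {c} [] [] e
      with () ← subst (coloredDegree F u ∈_) (↭-empty-inv DS↭[]) (∈-map⁺ (coloredDegree F)
             (∈-filter⁺ (_∈? ColoredGraph.vertices F) (∈-allFin u) (ColoredGraph.closed F e∈B u∈e)))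

theorem2 : ∃[ K ] ((c : ℕ) .{{_ : NonZero c}} (G : Graph) (s t : List (ColoredDegree c)) →
      let w = maxFrontierSize G
          w′ = w ⊔ 2
      in ∃[ Z ] (DD.Represents {c} {Graph.m G} Z (𝒢 G (λ F → Satisfies F s t))
           × DD.width Z ≤ 2 ^ (K * (c * (w′ * ⌊log₂ w′ ⌋)))
                          * length (𝒟 (s ++ t)) ^ w
                          * ∏[multiplicity+1] s))
theorem2 = 4 , construction
  where
  nonempty-case : (c : ℕ) .{{_ : NonZero c}} (G : Graph) (s t : List (ColoredDegree c)) →
    ∀ {x} → x ∈ s ++ t →
    let w = maxFrontierSize G
        w′ = w ⊔ 2
    in ∃[ Z ] (DD.Represents {c} {Graph.m G} Z (𝒢 G (λ F → Satisfies F s t))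
         × DD.width Z ≤ 2 ^ (4 * (c * (w′ * ⌊log₂ w′ ⌋)))
                        * length (𝒟 (s ++ t)) ^ w
                        * ∏[multiplicity+1] s)
  nonempty-case c G s t {x} x∈ =
    Z.diagram , Z.represents (λ h B colors → satisfies⇔accept {h} {B} colors) ,
    width-bound Z.diagram λ ℓ → ℕ.≤-trans (Prefixes.size≤keyCount G s t ℓ x∈)
      (keyCount-bound {c} (frontier≤maxFrontierSize G ℓ)
        (∈-length (from (∈-𝒟 (s ++ t)) (x , x∈ , Pointwise.refl ℕ.≤-refl)))
        (product-suc>0 (multiplicity s) (deduplicate _≟ᵈ_ s)))
    where
    open Subgraphs G s t
    module Z = Diagram Accept accept?

  construction : (c : ℕ) .{{_ : NonZero c}} (G : Graph) (s t : List (ColoredDegree c)) → _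
  construction c G []      []      =
    emptyDiagram , emptyDiagram-represents G , width-bound (emptyDiagram {c} {Graph.m G}) λ _ → z≤n
  construction c G []      (x ∷ t) = nonempty-case c G [] (x ∷ t) (here refl)
  construction c G (x ∷ s) t       = nonempty-case c G (x ∷ s) t (here refl)
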